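{- Let $c\geq 1$ be a real number and let $G$ be a finite graph with growth $f_G(r)\leq cr$ for every positive integer $r$. Then $G$ is isomorphic to a subgraph of $T\boxtimes K_{\lfloor 882c^3\rfloor}$ for some tree $T$.
   Context: The growth of a finite graph $G$ is the function $f_G\colon\mathbb{N}\to\mathbb{N}$ where $f_G(r)$ is the maximum of $|V(H)|$ over all subgraphs $H$ of $G$ of radius at most $r$. $K_t$ is the complete graph on $t$ vertices. The strong product $G\boxtimes H$ has vertex set $V(G)\times V(H)$, with distinct vertices $(v,w)$ and $(v',w')$ adjacent iff ($vv'\in E(G)$ and $w=w'$), or ($v=v'$ and $ww'\in E(H)$), or ($vv'\in E(G)$ and $ww'\in E(H)$). -}

module Defs where

open import Data.Nat.Base as ℕ using (ℕ; zero; suc)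
import Data.Nat.Properties as ℕ
open import Data.Integer.Base using (+_)
open import Data.Rational as ℚ using (ℚ; 0ℚ; 1ℚ)
import Data.Rational.Properties as ℚ
open import Data.Rational.Solver using (module +-*-Solver)
open import Data.Fin.Base using (Fin; zero; suc; inject₁; fromℕ)
open import Data.Fin.Properties using (_≟_; any?; all?)
open import Data.Fin.Subset using (Subset; inside; outside; _∈_; ∣_∣)
open import Data.Fin.Subset.Properties using (_∈?_)
open import Data.List.Base as List using (List; []; _∷_)
open import Data.List.Extrema.Nat using (max)
open import Data.Vec.Base as Vec using (Vec; []; _∷_)
open import Data.Product.Base using (Σ; ∃; _×_; _,_; proj₁; proj₂)
open import Data.Sum.Base using (_⊎_; inj₁; inj₂)
open import Function.Bundles using (_⇔_)
open import Function.Definitions using (Injective)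
open import Level using (0ℓ)
open import Relation.Binary.Core using (Rel)
open import Relation.Binary.Definitions using (Symmetric; Decidable)
open import Relation.Binary.PropositionalEquality
  using (_≡_; _≢_; refl; sym; ≢-sym; cong; subst)
open import Relation.Nullary using (¬_; Dec; map′; _×-dec_; _→-dec_)
open import Relation.Unary using (Pred)

-- Real numbers as Cauchy sequences of rationals with a modulus of
-- convergence (the modulus is the witness N of the inner ∃)

IsCauchy : (ℕ → ℚ) → Set
IsCauchy x = ∀ ε → 0ℚ ℚ.< ε →
  ∃ λ N → ∀ m n → N ℕ.≤ m → N ℕ.≤ n → ℚ.∣ x m ℚ.- x n ∣ ℚ.< ε

record ℝ : Set where
  constructor mkℝ
  field
    seq    : ℕ → ℚ
    cauchy : IsCauchy seq
open ℝ public

infix 4 _≤ᵣ_ _<ᵣ_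

_≤ᵣ_ : Rel ℝ 0ℓ
x ≤ᵣ y = ∀ ε → 0ℚ ℚ.< ε →
  ∃ λ N → ∀ n → N ℕ.≤ n → seq x n ℚ.≤ seq y n ℚ.+ ε

_<ᵣ_ : Rel ℝ 0ℓ
x <ᵣ y = ∃ λ ε → 0ℚ ℚ.< ε ×
  ∃ λ N → ∀ n → N ℕ.≤ n → seq x n ℚ.+ ε ℚ.≤ seq y n

ℚ⇒ℝ : ℚ → ℝ
ℚ⇒ℝ q = mkℝ (λ _ → q) λ ε 0<ε → 0 , λ _ _ _ _ →
  subst (ℚ._< ε) (sym (cong ℚ.∣_∣ (ℚ.+-inverseʳ q))) 0<ε

ℕ⇒ℝ : ℕ → ℝ
ℕ⇒ℝ n = ℚ⇒ℝ (+ n ℚ./ 1)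

private
  -- an eventual bound, of the form 1 + ∣ x N ∣
  bound : (x : ℝ) → ∃ λ b → 0ℚ ℚ.< b ×
    ∃ λ N → ∀ n → N ℕ.≤ n → ℚ.∣ seq x n ∣ ℚ.≤ b
  bound x with cauchy x 1ℚ (ℚ.positive⁻¹ 1ℚ)
  ... | N , close = 1ℚ ℚ.+ ℚ.∣ seq x N ∣
                  , ℚ.+-mono-<-≤ (ℚ.positive⁻¹ 1ℚ) (ℚ.0≤∣p∣ (seq x N))
                  , N , bounded
    where
    bounded : ∀ n → N ℕ.≤ n → ℚ.∣ seq x n ∣ ℚ.≤ 1ℚ ℚ.+ ℚ.∣ seq x N ∣
    bounded n N≤n = begin
      ℚ.∣ a ∣                     ≡⟨ cong ℚ.∣_∣ (solve 2 (λ a b → a := (a :- b) :+ b) refl a b) ⟩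
      ℚ.∣ (a ℚ.- b) ℚ.+ b ∣       ≤⟨ ℚ.∣p+q∣≤∣p∣+∣q∣ (a ℚ.- b) b ⟩
      ℚ.∣ a ℚ.- b ∣ ℚ.+ ℚ.∣ b ∣   ≤⟨ ℚ.+-monoˡ-≤ ℚ.∣ b ∣ (ℚ.<⇒≤ (close n N N≤n ℕ.≤-refl)) ⟩
      1ℚ ℚ.+ ℚ.∣ b ∣              ∎
      where
      open ℚ.≤-Reasoning
      open +-*-Solver
      a b : ℚ
      a = seq x n
      b = seq x N

  *-cauchy : (x y : ℝ) → IsCauchy (λ n → seq x n ℚ.* seq y n)
  *-cauchy x y ε 0<ε = N , close
    where
    bx by : ℚ
    bx = proj₁ (bound x)
    by = proj₁ (bound y)

    instance
      posε  : ℚ.Positive ε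
      posε  = ℚ.positive 0<ε
      posbx : ℚ.Positive bx
      posbx = ℚ.positive (proj₁ (proj₂ (bound x)))
      posby : ℚ.Positive by
      posby = ℚ.positive (proj₁ (proj₂ (bound y)))
      posB  : ℚ.Positive (bx ℚ.+ by)
      posB  = ℚ.pos+pos⇒pos bx by
      nzB   : ℚ.NonZero (bx ℚ.+ by)
      nzB   = ℚ.pos⇒nonZero (bx ℚ.+ by)
      pos1/B : ℚ.Positive (ℚ.1/ (bx ℚ.+ by))
      pos1/B = ℚ.1/pos⇒pos (bx ℚ.+ by)

    δ : ℚ
    δ = ℚ.1/ (bx ℚ.+ by) ℚ.* ε

    0<δ : 0ℚ ℚ.< δ
    0<δ = ℚ.positive⁻¹ δ {{ℚ.pos*pos⇒pos (ℚ.1/ (bx ℚ.+ by)) ε}}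

    N₁ N₂ N₃ N₄ N : ℕ
    N₁ = proj₁ (proj₂ (proj₂ (bound x)))
    N₂ = proj₁ (proj₂ (proj₂ (bound y)))
    N₃ = proj₁ (cauchy x δ 0<δ)
    N₄ = proj₁ (cauchy y δ 0<δ)
    N  = (N₁ ℕ.⊔ N₂) ℕ.⊔ (N₃ ℕ.⊔ N₄)

    N₁≤N : N₁ ℕ.≤ N
    N₁≤N = ℕ.≤-trans (ℕ.m≤m⊔n N₁ N₂) (ℕ.m≤m⊔n _ _)
    N₂≤N : N₂ ℕ.≤ N
    N₂≤N = ℕ.≤-trans (ℕ.m≤n⊔m N₁ N₂) (ℕ.m≤m⊔n _ _)
    N₃≤N : N₃ ℕ.≤ N
    N₃≤N = ℕ.≤-trans (ℕ.m≤m⊔n N₃ N₄) (ℕ.m≤n⊔m (N₁ ℕ.⊔ N₂) _)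
    N₄≤N : N₄ ℕ.≤ N
    N₄≤N = ℕ.≤-trans (ℕ.m≤n⊔m N₃ N₄) (ℕ.m≤n⊔m (N₁ ℕ.⊔ N₂) _)

    -- ∣ p ∣ ≤ b and ∣ q ∣ < δ give ∣ p * q ∣ < b * δ
    product< : ∀ b .{{_ : ℚ.Positive b}} p q →
               ℚ.∣ p ∣ ℚ.≤ b → ℚ.∣ q ∣ ℚ.< δ → ℚ.∣ p ℚ.* q ∣ ℚ.< b ℚ.* δ
    product< b p q p≤b q<δ = begin-strict
      ℚ.∣ p ℚ.* q ∣        ≡⟨ ℚ.∣p*q∣≡∣p∣*∣q∣ p q ⟩
      ℚ.∣ p ∣ ℚ.* ℚ.∣ q ∣  ≤⟨ ℚ.*-monoʳ-≤-nonNeg ℚ.∣ q ∣ {{ℚ.∣-∣-nonNeg q}} p≤b ⟩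
      b ℚ.* ℚ.∣ q ∣        <⟨ ℚ.*-monoʳ-<-pos b q<δ ⟩
      b ℚ.* δ              ∎
      where open ℚ.≤-Reasoning

    close : ∀ m n → N ℕ.≤ m → N ℕ.≤ n →
            ℚ.∣ seq x m ℚ.* seq y m ℚ.- seq x n ℚ.* seq y n ∣ ℚ.< ε
    close m n N≤m N≤n = begin-strict
      ℚ.∣ xm ℚ.* ym ℚ.- xn ℚ.* yn ∣
        ≡⟨ cong ℚ.∣_∣ (solve 4 (λ xm ym xn yn →
             xm :* ym :- xn :* yn := xm :* (ym :- yn) :+ yn :* (xm :- xn))
             refl xm ym xn yn) ⟩
      ℚ.∣ xm ℚ.* (ym ℚ.- yn) ℚ.+ yn ℚ.* (xm ℚ.- xn) ∣
        ≤⟨ ℚ.∣p+q∣≤∣p∣+∣q∣ (xm ℚ.* (ym ℚ.- yn)) (yn ℚ.* (xm ℚ.- xn)) ⟩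
      ℚ.∣ xm ℚ.* (ym ℚ.- yn) ∣ ℚ.+ ℚ.∣ yn ℚ.* (xm ℚ.- xn) ∣
        <⟨ ℚ.+-mono-<
             (product< bx xm (ym ℚ.- yn)
               (proj₂ (proj₂ (proj₂ (bound x))) m (ℕ.≤-trans N₁≤N N≤m))
               (proj₂ (cauchy y δ 0<δ) m n (ℕ.≤-trans N₄≤N N≤m) (ℕ.≤-trans N₄≤N N≤n)))
             (product< by yn (xm ℚ.- xn)
               (proj₂ (proj₂ (proj₂ (bound y))) n (ℕ.≤-trans N₂≤N N≤n))
               (proj₂ (cauchy x δ 0<δ) m n (ℕ.≤-trans N₃≤N N≤m) (ℕ.≤-trans N₃≤N N≤n))) ⟩
      bx ℚ.* δ ℚ.+ by ℚ.* δ
        ≡⟨ sym (ℚ.*-distribʳ-+ δ bx by) ⟩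
      (bx ℚ.+ by) ℚ.* (ℚ.1/ (bx ℚ.+ by) ℚ.* ε)
        ≡⟨ sym (ℚ.*-assoc (bx ℚ.+ by) (ℚ.1/ (bx ℚ.+ by)) ε) ⟩
      ((bx ℚ.+ by) ℚ.* ℚ.1/ (bx ℚ.+ by)) ℚ.* ε
        ≡⟨ cong (ℚ._* ε) (ℚ.*-inverseʳ (bx ℚ.+ by)) ⟩
      1ℚ ℚ.* ε
        ≡⟨ ℚ.*-identityˡ ε ⟩
      ε ∎
      where
      open ℚ.≤-Reasoning
      open +-*-Solver
      xm ym xn yn : ℚ
      xm = seq x m
      ym = seq y m
      xn = seq x n
      yn = seq y n

infixl 7 _*ᵣ_
infixr 8 _^ᵣ_

_*ᵣ_ : ℝ → ℝ → ℝ
x *ᵣ y = mkℝ (λ n → seq x n ℚ.* seq y n) (*-cauchy x y)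

_^ᵣ_ : ℝ → ℕ → ℝ
x ^ᵣ zero  = ℕ⇒ℝ 1
x ^ᵣ suc n = x *ᵣ x ^ᵣ n

-- k = ⌊ x ⌋, for x ≥ 0.  A relation, since the floor of a real number is
-- not computable; classically exactly one k satisfies it.
IsFloor : ℕ → ℝ → Set
IsFloor k x = ℕ⇒ℝ k ≤ᵣ x × x <ᵣ ℕ⇒ℝ (suc k)

record Graph (V : Set) : Set₁ where
  field
    Adj     : Rel V 0ℓ
    symm    : Symmetric Adj
    irrefl  : ∀ {v} → ¬ Adj v v
open Graph public

record FiniteGraph (n : ℕ) : Set₁ where
  field
    graph : Graph (Fin n)
    adj?  : Decidable (Adj graph)
open FiniteGraph public

-- Walk E k u v: a walk with k edges from u to v along E
data Walk {V : Set} (E : Rel V 0ℓ) : ℕ → Rel V 0ℓ where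
  []  : ∀ {v} → Walk E 0 v v
  _∷_ : ∀ {k u v w} → E u v → Walk E k v w → Walk E (suc k) u w

Distance≤ : {V : Set} → Rel V 0ℓ → ℕ → Rel V 0ℓ
Distance≤ E r u v = ∃ λ k → k ℕ.≤ r × Walk E k u v

-- The vertex set P and edge set E form a subgraph of G.
record IsSubgraph {V : Set} (G : Graph V) (P : Pred V 0ℓ) (E : Rel V 0ℓ) : Set where
  field
    edge⇒adj : ∀ u v → E u v → Adj G u v
    edge⇒end : ∀ u v → E u v → P u × P v
    edge-sym : ∀ u v → E u v → E v u

-- Some vertex of the graph (P , E) is within distance r of all of them.
Radius≤ : {V : Set} → Pred V 0ℓ → Rel V 0ℓ → ℕ → Set
Radius≤ P E r = ∃ λ u → P u × ∀ v → P v → Distance≤ E r u v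

-- A candidate vertex set together with a candidate edge set, the latter
-- given by its adjacency matrix
Candidate : ℕ → Set
Candidate n = Subset n × Vec (Subset n) n

Vertex : ∀ {n} → Candidate n → Pred (Fin n) 0ℓ
Vertex (S , M) v = v ∈ S

Edge : ∀ {n} → Candidate n → Rel (Fin n) 0ℓ
Edge (S , M) u v = v ∈ Vec.lookup M u

-- all vectors of length n with entries from a list
vectors : {A : Set} → List A → (n : ℕ) → List (Vec A n)
vectors xs zero    = [] ∷ []
vectors xs (suc n) = List.cartesianProductWith _∷_ xs (vectors xs n)

candidates : (n : ℕ) → List (Candidate n)
candidates n = List.cartesianProduct subsets (vectors subsets n)
  where
  subsets : List (Subset n)
  subsets = vectors (inside ∷ outside ∷ []) n

walk? : ∀ {n} {E : Rel (Fin n) 0ℓ} → Decidable E → ∀ k → Decidable (Walk E k)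
walk? E? zero    u v = map′ (λ { refl → [] }) (λ { [] → refl }) (u ≟ v)
walk? E? (suc k) u v =
  map′ (λ { (_ , e , p) → e ∷ p }) (λ { (e ∷ p) → _ , e , p })
       (any? λ w → E? u w ×-dec walk? E? k w v)

distance≤? : ∀ {n} {E : Rel (Fin n) 0ℓ} → Decidable E → ∀ r → Decidable (Distance≤ E r)
distance≤? E? r u v =
  map′ (λ { (k , k<1+r , p) → k , ℕ.≤-pred k<1+r , p })
       (λ { (k , k≤r , p) → k , ℕ.s≤s k≤r , p })
       (ℕ.anyUpTo? (λ k → walk? E? k u v) (suc r))

module _ {n} (H : Candidate n) where

  vertex? : ∀ v → Dec (Vertex H v)
  vertex? v = v ∈? proj₁ H

  edge? : Decidable (Edge H)
  edge? u v = v ∈? Vec.lookup (proj₂ H) u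

  isSubgraph? : (G : FiniteGraph n) → Dec (IsSubgraph (graph G) (Vertex H) (Edge H))
  isSubgraph? G =
    map′ (λ { (a , b , c) → record { edge⇒adj = a ; edge⇒end = b ; edge-sym = c } })
         (λ s → IsSubgraph.edge⇒adj s , IsSubgraph.edge⇒end s , IsSubgraph.edge-sym s)
         ( (all? λ u → all? λ v → edge? u v →-dec adj? G u v)
     ×-dec (all? λ u → all? λ v → edge? u v →-dec (vertex? u ×-dec vertex? v))
     ×-dec (all? λ u → all? λ v → edge? u v →-dec edge? v u) )

  radius≤? : ∀ r → Dec (Radius≤ (Vertex H) (Edge H) r)
  radius≤? r = any? λ u → vertex? u ×-dec
    all? λ v → vertex? v →-dec distance≤? edge? r u v

-- The value is 0 on the graph without vertices.
growth : ∀ {n} → FiniteGraph n → ℕ → ℕ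
growth {n} G r =
  max 0 (List.map (λ H → ∣ proj₁ H ∣)
    (List.filter (λ H → isSubgraph? H G ×-dec radius≤? H r) (candidates n)))

-- v₀ , … , vₘ₊₂ are distinct and consecutive ones are adjacent, cyclically.
Cycle : {V : Set} → Graph V → Set
Cycle {V} G = ∃ λ m → Σ (Fin (3 ℕ.+ m) → V) λ v →
    Injective _≡_ _≡_ v
  × (∀ (i : Fin (2 ℕ.+ m)) → Adj G (v (inject₁ i)) (v (suc i)))
  × Adj G (v (fromℕ (2 ℕ.+ m))) (v zero)

record IsTree {V : Set} (T : Graph V) : Set where
  field
    nonempty  : V
    connected : ∀ u v → ∃ λ k → Walk (Adj T) k u v
    acyclic   : ¬ Cycle T

K : (t : ℕ) → Graph (Fin t)
K t = record { Adj = _≢_ ; symm = ≢-sym ; irrefl = λ v≢v → v≢v refl }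

infixr 7 _⊠_

_⊠_ : {V W : Set} → Graph V → Graph W → Graph (V × W)
Adj (G ⊠ H) (v , w) (v′ , w′) =
    (Adj G v v′ × w ≡ w′)
  ⊎ (v ≡ v′ × Adj H w w′)
  ⊎ (Adj G v v′ × Adj H w w′)
symm (G ⊠ H) (inj₁ (a , e))        = inj₁ (symm G a , sym e)
symm (G ⊠ H) (inj₂ (inj₁ (e , b))) = inj₂ (inj₁ (sym e , symm H b))
symm (G ⊠ H) (inj₂ (inj₂ (a , b))) = inj₂ (inj₂ (symm G a , symm H b))
irrefl (G ⊠ H) (inj₁ (a , _))        = irrefl G a
irrefl (G ⊠ H) (inj₂ (inj₁ (_ , b))) = irrefl H b
irrefl (G ⊠ H) (inj₂ (inj₂ (a , _))) = irrefl G a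

-- φ is an isomorphism from G to the graph with vertex set P and edge set E.
record IsIsomorphism {V W : Set} (G : Graph V) (P : Pred W 0ℓ) (E : Rel W 0ℓ)
                     (φ : V → W) : Set where
  field
    injective : Injective _≡_ _≡_ φ
    image     : ∀ w → P w ⇔ (∃ λ v → φ v ≡ w)
    edges     : ∀ u v → Adj G u v ⇔ E (φ u) (φ v)

IsomorphicToSubgraph : {V W : Set} → Graph V → Graph W → Set₁
IsomorphicToSubgraph {V} {W} G Q =
  ∃ λ (P : Pred W 0ℓ) → ∃ λ (E : Rel W 0ℓ) →
    IsSubgraph Q P E × ∃ λ (φ : V → W) → IsIsomorphism G P E φ

module Submission where

open import Defs
open import Data.Nat.Base
open import Data.Nat.Coprimality using (Coprime)
open import Data.Nat.DivMod
open import Data.Nat.Properties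
open import Data.Nat.Tactic.RingSolver using (solve-∀)
open import Data.Bool.Base using (Bool; true; false; if_then_else_)
import Data.Bool.Properties as Bool
open import Data.Fin.Base as Fin using (Fin; zero; suc; inject₁; fromℕ; fromℕ<; toℕ)
import Data.Fin.Properties as Fin
open import Data.Fin.Relation.Unary.Top using (view; ‵fromℕ; ‵inject₁)
open import Data.Fin.Subset
open import Data.Fin.Subset.Properties
open import Data.Integer.Base as ℤ using (+_; -[1+_])
import Data.Integer.Properties as ℤ
open import Data.List.Base as List using (List; []; _∷_; length; allFin)
open import Data.List.Extrema.Nat using (v≤max⁺)
import Data.List.Membership.Propositional as L
open import Data.List.Membership.Propositional.Properties
  using (∈-cartesianProduct⁺; ∈-cartesianProductWith⁺; ∈-filter⁺; ∈-map⁺; ∈-allFin)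
open import Data.List.Properties using (length-map; ∷-injectiveʳ; ≡-dec)
open import Data.List.Relation.Unary.All as All using (All; []; _∷_)
import Data.List.Relation.Unary.All.Properties as All
open import Data.List.Relation.Unary.Any as Any using (Any; here; there)
import Data.List.Relation.Unary.Any.Properties as Any
open import Data.Product.Base using (Σ; ∃; ∃₂; _×_; _,_; proj₁; proj₂)
open import Data.Rational as ℚ using (ℚ; mkℚ; 0ℚ; 1ℚ; toℚᵘ)
import Data.Rational.Properties as ℚ
open import Data.Rational.Solver using (module +-*-Solver)
open import Data.Rational.Unnormalised.Base as ℚᵘ using (mkℚᵘ)
import Data.Rational.Unnormalised.Properties as ℚᵘ
open import Data.Sum.Base as Sum using (_⊎_; inj₁; inj₂; [_,_]′)
open import Data.Vec.Base using (Vec; []; _∷_; here; there; tabulate)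
open import Data.Vec.Properties using ([]=⇒lookup; lookup⇒[]=; lookup∘tabulate)
open import Function.Base using (_∘_; case_of_)
open import Function.Bundles using (mk⇔)
open import Level using (0ℓ)
open import Relation.Binary.Core using (Rel)
open import Relation.Binary.Definitions using (DecidableEquality; tri<; tri≈; tri>)
open import Relation.Binary.PropositionalEquality
open import Relation.Nullary
open import Relation.Nullary.Decidable using (dec-true; dec-false)
open import Relation.Unary using (Pred; Decidable)

-- Separators.  Let S be a set of more than 12w vertices, w ≈ 10c².  Take the
-- largest r such that every ball of radius r contains at most |S|/3 vertices of
-- S; then some ball B of radius r + 1 contains more, and r ≥ 4.  With h = ⌊r/4⌋,
-- a maximal family of disjoint balls of radius h with centres in B has at most
-- 5c members by linear growth, and the balls of radius 2h with the same centres
-- cover B.  Each of these can be enlarged to a radius between 2h and 4h where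
-- the next layer has at most 2c vertices.  Adding the enlarged balls one at a
-- time until they contain more than |S|/3 vertices of S gives a set A which
-- contains between |S|/3 and 2|S|/3 of S and has at most w outer neighbours.
-- If there is no largest r, components take the place of the enlarged balls.
--
-- Tree-partitions.  These are built recursively with a prescribed set S in the
-- root bag.  If |S| ≤ 12w, make S the root bag and recurse on the rest, where
-- the neighbours of S are prescribed.  Otherwise split along a separator, add
-- the separator to the prescribed sets on both sides, and glue the two root
-- bags.  All bags have at most 24wc ≤ 240c³ vertices; the slack up to 882c³
-- absorbs replacing the real number c by a rational upper bound below 3c/2.

-- Finite subsets

∣p∪q∣+∣p∩q∣≡∣p∣+∣q∣ : ∀ {n} (p q : Subset n) → ∣ p ∪ q ∣ + ∣ p ∩ q ∣ ≡ ∣ p ∣ + ∣ q ∣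
∣p∪q∣+∣p∩q∣≡∣p∣+∣q∣ [] [] = refl
∣p∪q∣+∣p∩q∣≡∣p∣+∣q∣ (false ∷ p) (false ∷ q) = ∣p∪q∣+∣p∩q∣≡∣p∣+∣q∣ p q
∣p∪q∣+∣p∩q∣≡∣p∣+∣q∣ (true ∷ p) (false ∷ q) = cong suc (∣p∪q∣+∣p∩q∣≡∣p∣+∣q∣ p q)
∣p∪q∣+∣p∩q∣≡∣p∣+∣q∣ (false ∷ p) (true ∷ q) =
  trans (cong suc (∣p∪q∣+∣p∩q∣≡∣p∣+∣q∣ p q)) (sym (+-suc ∣ p ∣ ∣ q ∣))
∣p∪q∣+∣p∩q∣≡∣p∣+∣q∣ (true ∷ p) (true ∷ q) = cong suc (trans (+-suc ∣ p ∪ q ∣ ∣ p ∩ q ∣)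
  (trans (cong suc (∣p∪q∣+∣p∩q∣≡∣p∣+∣q∣ p q)) (sym (+-suc ∣ p ∣ ∣ q ∣))))

∣p∩q∣+∣p─q∣≡∣p∣ : ∀ {n} (p q : Subset n) → ∣ p ∩ q ∣ + ∣ p ─ q ∣ ≡ ∣ p ∣
∣p∩q∣+∣p─q∣≡∣p∣ [] [] = refl
∣p∩q∣+∣p─q∣≡∣p∣ (false ∷ p) (false ∷ q) = ∣p∩q∣+∣p─q∣≡∣p∣ p q
∣p∩q∣+∣p─q∣≡∣p∣ (true ∷ p) (false ∷ q) =
  trans (+-suc ∣ p ∩ q ∣ ∣ p ─ q ∣) (cong suc (∣p∩q∣+∣p─q∣≡∣p∣ p q))
∣p∩q∣+∣p─q∣≡∣p∣ (false ∷ p) (true ∷ q) = ∣p∩q∣+∣p─q∣≡∣p∣ p q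
∣p∩q∣+∣p─q∣≡∣p∣ (true ∷ p) (true ∷ q) = cong suc (∣p∩q∣+∣p─q∣≡∣p∣ p q)

∣p∪q∣≤∣p∣+∣q∣ : ∀ {n} (p q : Subset n) → ∣ p ∪ q ∣ ≤ ∣ p ∣ + ∣ q ∣
∣p∪q∣≤∣p∣+∣q∣ p q = subst (∣ p ∪ q ∣ ≤_) (∣p∪q∣+∣p∩q∣≡∣p∣+∣q∣ p q) (m≤m+n _ _)

disjoint⇒∣p∪q∣≡∣p∣+∣q∣ : ∀ {n} (p q : Subset n) → (∀ {x} → x ∈ p → x ∉ q) →
                         ∣ p ∪ q ∣ ≡ ∣ p ∣ + ∣ q ∣
disjoint⇒∣p∪q∣≡∣p∣+∣q∣ {n} p q dis = begin
  ∣ p ∪ q ∣               ≡⟨ +-identityʳ _ ⟨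
  ∣ p ∪ q ∣ + 0           ≡⟨ cong (λ k → ∣ p ∪ q ∣ + k) (∣⊥∣≡0 n) ⟨
  ∣ p ∪ q ∣ + ∣ ⊥ {n} ∣   ≡⟨ cong (λ s → ∣ p ∪ q ∣ + ∣ s ∣) (Empty-unique none) ⟨
  ∣ p ∪ q ∣ + ∣ p ∩ q ∣   ≡⟨ ∣p∪q∣+∣p∩q∣≡∣p∣+∣q∣ p q ⟩
  ∣ p ∣ + ∣ q ∣           ∎
  where
  open ≡-Reasoning
  none : Empty (p ∩ q)
  none (x , x∈) = dis (proj₁ (x∈p∩q⁻ p q x∈)) (proj₂ (x∈p∩q⁻ p q x∈))

x∈p─q⁻ : ∀ {n} (p q : Subset n) {x} → x ∈ p ─ q → x ∈ p × x ∉ q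
x∈p─q⁻ (s ∷ p) (false ∷ q) here = here , λ ()
x∈p─q⁻ (s ∷ p) (false ∷ q) (there x∈) with x∈p─q⁻ p q x∈
... | x∈p , x∉q = there x∈p , λ { (there x∈q) → x∉q x∈q }
x∈p─q⁻ (s ∷ p) (true ∷ q) (there x∈) with x∈p─q⁻ p q x∈
... | x∈p , x∉q = there x∈p , λ { (there x∈q) → x∉q x∈q }

⋃[_]_ : ∀ {m n} → Subset m → (Fin m → Subset n) → Subset n
⋃[ [] ] R        = ⊥
⋃[ true ∷ p ] R  = R zero ∪ ⋃[ p ] (R ∘ suc)
⋃[ false ∷ p ] R = ⋃[ p ] (R ∘ suc)

x∈⋃⁺ : ∀ {m n} {p : Subset m} (R : Fin m → Subset n) {i x} → i ∈ p → x ∈ R i → x ∈ ⋃[ p ] R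
x∈⋃⁺ R here x∈ = x∈p∪q⁺ (inj₁ x∈)
x∈⋃⁺ {p = true ∷ p} R (there i∈p) x∈ = x∈p∪q⁺ (inj₂ (x∈⋃⁺ (R ∘ suc) i∈p x∈))
x∈⋃⁺ {p = false ∷ p} R (there i∈p) x∈ = x∈⋃⁺ (R ∘ suc) i∈p x∈

x∈⋃⁻ : ∀ {m n} (p : Subset m) (R : Fin m → Subset n) {x} → x ∈ ⋃[ p ] R → ∃ λ i → i ∈ p × x ∈ R i
x∈⋃⁻ [] R x∈ = contradiction x∈ ∉⊥
x∈⋃⁻ (true ∷ p) R x∈ with x∈p∪q⁻ (R zero) (⋃[ p ] (R ∘ suc)) x∈
... | inj₁ x∈R = zero , here , x∈R
... | inj₂ x∈⋃ with x∈⋃⁻ p (R ∘ suc) x∈⋃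
...   | i , i∈p , x∈R = suc i , there i∈p , x∈R
x∈⋃⁻ (false ∷ p) R x∈ with x∈⋃⁻ p (R ∘ suc) x∈
... | i , i∈p , x∈R = suc i , there i∈p , x∈R

∣⋃∣≤ : ∀ {m n} (p : Subset m) (R : Fin m → Subset n) {d} →
       (∀ i → i ∈ p → ∣ R i ∣ ≤ d) → ∣ ⋃[ p ] R ∣ ≤ ∣ p ∣ * d
∣⋃∣≤ {n = n} [] R h = ≤-reflexive (∣⊥∣≡0 n)
∣⋃∣≤ (true ∷ p) R h = ≤-trans (∣p∪q∣≤∣p∣+∣q∣ (R zero) _)
  (+-mono-≤ (h zero here) (∣⋃∣≤ p (R ∘ suc) λ i i∈p → h (suc i) (there i∈p)))
∣⋃∣≤ (false ∷ p) R h = ∣⋃∣≤ p (R ∘ suc) λ i i∈p → h (suc i) (there i∈p)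

module _ {n} {P : Pred (Fin n) 0ℓ} (P? : Decidable P) where

  ⟪_⟫ : Subset n
  ⟪_⟫ = tabulate (does ∘ P?)

  x∈⟪⟫⁺ : ∀ {x} → P x → x ∈ ⟪_⟫
  x∈⟪⟫⁺ {x} px = lookup⇒[]= x _ (trans (lookup∘tabulate _ x) (dec-true (P? x) px))

  x∈⟪⟫⁻ : ∀ {x} → x ∈ ⟪_⟫ → P x
  x∈⟪⟫⁻ {x} x∈ with P? x | trans (sym (lookup∘tabulate (does ∘ P?) x)) ([]=⇒lookup x∈)
  ... | yes px | _ = px
  ... | no _   | ()

-- Balls and growth

∈-vectors : ∀ {A : Set} {xs : List A} → (∀ x → x L.∈ xs) → ∀ {n} (v : Vec A n) → v L.∈ vectors xs n
∈-vectors all []      = Any.here refl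
∈-vectors all (x ∷ v) = ∈-cartesianProductWith⁺ _∷_ (all x) (∈-vectors all v)

∈-candidates : ∀ {n} (H : Candidate n) → H L.∈ candidates n
∈-candidates (S , M) = ∈-cartesianProduct⁺ (∈-vectors side S) (∈-vectors (∈-vectors side) M)
  where
  side : ∀ s → s L.∈ (inside List.∷ outside List.∷ List.[])
  side true  = Any.here refl
  side false = Any.there (Any.here refl)

∣H∣≤growth : ∀ {n} (G : FiniteGraph n) r (H : Candidate n) → IsSubgraph (graph G) (Vertex H) (Edge H) →
             Radius≤ (Vertex H) (Edge H) r → ∣ proj₁ H ∣ ≤ growth G r
∣H∣≤growth G r H sub rad = v≤max⁺ 0 _ (inj₂ (Any.map ≤-reflexive
  (∈-map⁺ (λ H → ∣ proj₁ H ∣) (∈-filter⁺ _ (∈-candidates H) (sub , rad)))))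

_∷ʳ_ : ∀ {V : Set} {E : Rel V 0ℓ} {k u v w} → Walk E k u v → E v w → Walk E (suc k) u w
[]      ∷ʳ e = e ∷ []
(f ∷ p) ∷ʳ e = f ∷ (p ∷ʳ e)

module Balls {n} (G : FiniteGraph n) where

  Nbr : Fin n → Subset n
  Nbr u = ⟪ adj? G u ⟫

  -- The outer vertex boundary of `A` in the subgraph induced by `U`.
  ∂ : Subset n → Subset n → Subset n
  ∂ U A = (⋃[ A ] Nbr ∩ U) ─ A

  x∈∂⁺ : ∀ {U A a x} → a ∈ A → Adj (graph G) a x → x ∈ U → x ∉ A → x ∈ ∂ U A
  x∈∂⁺ {U} {A} {a} a∈A ax x∈U x∉A =
    x∈p∧x∉q⇒x∈p─q (x∈p∩q⁺ (x∈⋃⁺ Nbr a∈A (x∈⟪⟫⁺ (adj? G a) ax) , x∈U)) x∉A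

  x∈∂⁻ : ∀ U A {x} → x ∈ ∂ U A → (∃ λ a → a ∈ A × Adj (graph G) a x) × x ∈ U × x ∉ A
  x∈∂⁻ U A x∈ with x∈p─q⁻ (⋃[ A ] Nbr ∩ U) A x∈
  ... | x∈∩ , x∉A with x∈p∩q⁻ (⋃[ A ] Nbr) U x∈∩
  ... | x∈⋃ , x∈U with x∈⋃⁻ A Nbr x∈⋃
  ... | a , a∈A , x∈N = (a , a∈A , x∈⟪⟫⁻ (adj? G a) x∈N) , x∈U , x∉A

  ∂-∪ : ∀ U A B → ∂ U (A ∪ B) ⊆ ∂ U A ∪ ∂ U B
  ∂-∪ U A B x∈ with x∈∂⁻ U (A ∪ B) x∈
  ... | (a , a∈ , ax) , x∈U , x∉ with x∈p∪q⁻ A B a∈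
  ... | inj₁ a∈A = x∈p∪q⁺ (inj₁ (x∈∂⁺ a∈A ax x∈U (x∉ ∘ x∈p∪q⁺ ∘ inj₁)))
  ... | inj₂ a∈B = x∈p∪q⁺ (inj₂ (x∈∂⁺ a∈B ax x∈U (x∉ ∘ x∈p∪q⁺ ∘ inj₂)))

  -- Distances are measured inside the subgraph induced by `U`, because the recursion works on
  -- shrinking vertex sets. The centre belongs to its ball even if it lies outside `U`; hence the
  -- hypotheses `u ∈ U` below.
  ball : Subset n → Fin n → ℕ → Subset n
  ball U u zero    = ⁅ u ⁆
  ball U u (suc r) = ball U u r ∪ ∂ U (ball U u r)

  module _ (U : Subset n) where

    ∣ball-suc∣ : ∀ u r → ∣ ball U u (suc r) ∣ ≡ ∣ ball U u r ∣ + ∣ ∂ U (ball U u r) ∣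
    ∣ball-suc∣ u r = disjoint⇒∣p∪q∣≡∣p∣+∣q∣ (ball U u r) _
      λ x∈ x∈∂ → proj₂ (proj₂ (x∈∂⁻ U (ball U u r) x∈∂)) x∈

    ball-step : ∀ u r {a x} → a ∈ ball U u r → Adj (graph G) a x → x ∈ U → x ∈ ball U u (suc r)
    ball-step u r {a} {x} a∈ ax x∈U with x ∈? ball U u r
    ... | yes x∈ = x∈p∪q⁺ (inj₁ x∈)
    ... | no x∉  = x∈p∪q⁺ (inj₂ (x∈∂⁺ a∈ ax x∈U x∉))

    ball-suc⁻ : ∀ u r {x} → x ∈ ball U u (suc r) →
                x ∈ ball U u r ⊎ (∃ λ a → a ∈ ball U u r × Adj (graph G) a x) × x ∈ U
    ball-suc⁻ u r x∈ with x∈p∪q⁻ (ball U u r) _ x∈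
    ... | inj₁ x∈b = inj₁ x∈b
    ... | inj₂ x∈∂ with x∈∂⁻ U (ball U u r) x∈∂
    ... | a , x∈U , _ = inj₂ (a , x∈U)

    ball-mono : ∀ u {r s} → r ≤ s → ball U u r ⊆ ball U u s
    ball-mono u r≤s = mono (≤⇒≤′ r≤s)
      where
      mono : ∀ {r s} → r ≤′ s → ball U u r ⊆ ball U u s
      mono ≤′-refl       x∈ = x∈
      mono (≤′-step r≤s) x∈ = x∈p∪q⁺ (inj₁ (mono r≤s x∈))

    centre∈ball : ∀ u r → u ∈ ball U u r
    centre∈ball u r = ball-mono u {0} {r} z≤n (x∈⁅x⁆ u)

    ball⊆ : ∀ {u} → u ∈ U → ∀ r → ball U u r ⊆ U
    ball⊆ {u} u∈U zero x∈ with refl ← x∈⁅y⁆⇒x≡y u x∈ = u∈U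
    ball⊆ {u} u∈U (suc r) x∈ with ball-suc⁻ u r x∈
    ... | inj₁ x∈b       = ball⊆ u∈U r x∈b
    ... | inj₂ (_ , x∈U) = x∈U

    ball-trans : ∀ u r {v w} s → v ∈ ball U u r → w ∈ ball U v s → w ∈ ball U u (r + s)
    ball-trans u r {v} zero v∈ w∈ with refl ← x∈⁅y⁆⇒x≡y v w∈ =
      ball-mono u (m≤m+n r 0) v∈
    ball-trans u r {v} {w} (suc s) v∈ w∈ with ball-suc⁻ v s w∈
    ... | inj₁ w∈b = ball-mono u (+-monoʳ-≤ r (n≤1+n s)) (ball-trans u r s v∈ w∈b)
    ... | inj₂ ((a , a∈ , aw) , w∈U) = subst (λ k → w ∈ ball U u k) (sym (+-suc r s))
      (ball-step u (r + s) (ball-trans u r s v∈ a∈) aw w∈U)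

    ball-sym : ∀ {u v} r → u ∈ U → v ∈ ball U u r → u ∈ ball U v r
    ball-sym {u} zero u∈U v∈ with refl ← x∈⁅y⁆⇒x≡y u v∈ = v∈
    ball-sym {u} {v} (suc r) u∈U v∈ with ball-suc⁻ u r v∈
    ... | inj₁ v∈b = ball-mono v (n≤1+n r) (ball-sym r u∈U v∈b)
    ... | inj₂ ((a , a∈ , av) , v∈U) = ball-trans v 1 r
      (ball-step v 0 (x∈⁅x⁆ v) (symm (graph G) av) (ball⊆ u∈U r a∈)) (ball-sym r u∈U a∈)

    -- Every nonempty layer adds a vertex, and after an empty layer the ball never grows again.
    ball-closed-or-large : ∀ u r → (∀ k → ball U u k ⊆ ball U u r) ⊎ r < ∣ ball U u r ∣
    ball-closed-or-large u zero = inj₂ (≤-reflexive (sym (∣⁅x⁆∣≡1 u)))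
    ball-closed-or-large u (suc r) with ball-closed-or-large u r
    ... | inj₁ closed = inj₁ λ k x∈ → ball-mono u (n≤1+n r) (closed k x∈)
    ... | inj₂ large with nonempty? (∂ U (ball U u r))
    ... | yes (x , x∈) = inj₂ (begin
      2 + r                                     ≡⟨ +-comm 1 (suc r) ⟩
      suc r + 1                                 ≤⟨ +-mono-≤ large nonempty ⟩
      ∣ ball U u r ∣ + ∣ ∂ U (ball U u r) ∣     ≡⟨ ∣ball-suc∣ u r ⟨
      ∣ ball U u (suc r) ∣                      ∎)
      where
      open ≤-Reasoning
      nonempty : 1 ≤ ∣ ∂ U (ball U u r) ∣
      nonempty = subst (_≤ _) (∣⁅x⁆∣≡1 x) (p⊆q⇒∣p∣≤∣q∣
        λ y∈ → subst (_∈ _) (sym (x∈⁅y⁆⇒x≡y x y∈)) x∈)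
    ... | no empty = inj₁ λ k x∈ → ball-mono u (n≤1+n r) (closed k x∈)
      where
      closed : ∀ k → ball U u k ⊆ ball U u r
      closed zero x∈ = ball-mono u {0} {r} z≤n x∈
      closed (suc k) {x} x∈ with ball-suc⁻ u k x∈
      ... | inj₁ x∈b = closed k x∈b
      ... | inj₂ ((a , a∈ , ax) , x∈U) with x ∈? ball U u r
      ...   | yes x∈b = x∈b
      ...   | no x∉b  = contradiction (x , x∈∂⁺ (closed k a∈) ax x∈U x∉b) empty

    -- The ball with all edges of `G` inside it is a subgraph of radius at most `r` centred at `u`:
    -- following the layers gives short walks that never leave the ball.
    ∣ball∣≤growth : ∀ {u} → u ∈ U → ∀ r → ∣ ball U u r ∣ ≤ growth G r
    ∣ball∣≤growth {u} u∈U r = ∣H∣≤growth G r H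
      (record { edge⇒adj = λ x y e → proj₂ (proj₂ (edge⁻ e))
              ; edge⇒end = λ x y e → proj₁ (edge⁻ e) , proj₁ (proj₂ (edge⁻ e))
              ; edge-sym = λ x y e → edge⁺ (proj₁ (proj₂ (edge⁻ e)) , proj₁ (edge⁻ e)
                                           , symm (graph G) (proj₂ (proj₂ (edge⁻ e)))) })
      (u , centre∈ball u r , λ v v∈ → reach r ≤-refl v∈)
      where
      B : Subset n
      B = ball U u r
      E : Rel (Fin n) 0ℓ
      E x y = x ∈ B × y ∈ B × Adj (graph G) x y
      E? : ∀ x → Decidable (E x)
      E? x y = x ∈? B ×-dec y ∈? B ×-dec adj? G x y
      H : Candidate n
      H = B , tabulate λ x → ⟪ E? x ⟫
      edge⁺ : ∀ {x y} → E x y → Edge H x y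
      edge⁺ {x} {y} e = subst (y ∈_) (sym (lookup∘tabulate _ x)) (x∈⟪⟫⁺ (E? x) e)
      edge⁻ : ∀ {x y} → Edge H x y → E x y
      edge⁻ {x} {y} e = x∈⟪⟫⁻ (E? x) (subst (y ∈_) (lookup∘tabulate _ x) e)
      -- The edge set stays that of the ball of radius `r` while the induction runs over smaller
      -- radii `s`.
      reach : ∀ {v} s → s ≤ r → v ∈ ball U u s → Distance≤ (Edge H) s u v
      reach zero s≤r v∈ with refl ← x∈⁅y⁆⇒x≡y u v∈ = 0 , z≤n , []
      reach (suc s) s≤r v∈ with ball-suc⁻ u s v∈
      ... | inj₁ v∈b with reach s (<⇒≤ s≤r) v∈b
      ...   | k , k≤s , p = k , m≤n⇒m≤1+n k≤s , p
      reach (suc s) s≤r v∈ | inj₂ ((a , a∈ , av) , v∈U) with reach s (<⇒≤ s≤r) a∈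
      ... | k , k≤s , p = suc k , s≤s k≤s ,
        (p ∷ʳ edge⁺ (ball-mono u (<⇒≤ s≤r) a∈ , ball-mono u s≤r v∈ , av))

-- Separators

m*n≤o⇒m≤o/n : ∀ m n o .{{_ : NonZero n}} → m * n ≤ o → m ≤ o / n
m*n≤o⇒m≤o/n m n o m*n≤o = subst (_≤ o / n) (m*n/n≡m m n) (/-monoˡ-≤ n m*n≤o)

x∈⋃ : ∀ {n} {As : List (Subset n)} {x} → Any (x ∈_) As → x ∈ ⋃ As
x∈⋃ (here x∈)   = x∈p∪q⁺ (inj₁ x∈)
x∈⋃ (there any) = x∈p∪q⁺ (inj₂ (x∈⋃ any))

∩-monoʳ : ∀ {n} (S : Subset n) {A B : Subset n} → (∀ {x} → x ∈ S → x ∈ A → x ∈ B) → S ∩ A ⊆ S ∩ B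
∩-monoʳ S {A} f x∈ with x∈p∩q⁻ S A x∈
... | x∈S , x∈A = x∈p∩q⁺ (x∈S , f x∈S x∈A)

∣S∩A∪B∣≤ : ∀ {n} (S A B : Subset n) → ∣ S ∩ (A ∪ B) ∣ ≤ ∣ S ∩ A ∣ + ∣ S ∩ B ∣
∣S∩A∪B∣≤ S A B = subst (λ X → ∣ X ∣ ≤ ∣ S ∩ A ∣ + ∣ S ∩ B ∣) (sym (∩-distribˡ-∪ S A B))
  (∣p∪q∣≤∣p∣+∣q∣ (S ∩ A) (S ∩ B))

module Separation {n} (G : FiniteGraph n) (p q : ℕ) .{{_ : NonZero q}} (q≤p : q ≤ p)
  (linear : ∀ U u r → u ∈ U → 1 ≤ r → ∣ Balls.ball G U u r ∣ * q ≤ p * r) where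

  open Balls G

  -- With c = p/q, these bound the size of a thin layer, the number of packed balls, and the outer
  -- boundary of a separator.
  b t w : ℕ
  b = 2 * p / q
  t = 5 * p / q
  w = t * b

  ∣∂⋃∣≤ : ∀ U {k} As → All (λ A → ∣ ∂ U A ∣ ≤ k) As → ∣ ∂ U (⋃ As) ∣ ≤ length As * k
  ∣∂⋃∣≤ U [] [] = ≤-trans (p⊆q⇒∣p∣≤∣q∣ ∂⊥⊆⊥) (≤-reflexive (∣⊥∣≡0 n))
    where
    ∂⊥⊆⊥ : ∂ U ⊥ ⊆ ⊥
    ∂⊥⊆⊥ x∈ with x∈∂⁻ U ⊥ x∈
    ... | (a , a∈⊥ , _) , _ = contradiction a∈⊥ ∉⊥
  ∣∂⋃∣≤ U {k} (A ∷ As) (∂A≤ ∷ ∂As≤) = begin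
    ∣ ∂ U (A ∪ ⋃ As) ∣               ≤⟨ p⊆q⇒∣p∣≤∣q∣ (∂-∪ U A (⋃ As)) ⟩
    ∣ ∂ U A ∪ ∂ U (⋃ As) ∣           ≤⟨ ∣p∪q∣≤∣p∣+∣q∣ (∂ U A) (∂ U (⋃ As)) ⟩
    ∣ ∂ U A ∣ + ∣ ∂ U (⋃ As) ∣       ≤⟨ +-mono-≤ ∂A≤ (∣∂⋃∣≤ U As ∂As≤) ⟩
    k + length As * k                ∎
    where open ≤-Reasoning

  ⋃⊆ : ∀ {U : Subset n} As → All (λ A → A ⊆ U) As → ⋃ As ⊆ U
  ⋃⊆ []       []            x∈ = contradiction x∈ ∉⊥
  ⋃⊆ (A ∷ As) (A⊆U ∷ As⊆U) x∈ = [ A⊆U , ⋃⊆ As As⊆U ]′ (x∈p∪q⁻ A (⋃ As) x∈)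

  Balanced : Subset n → Subset n → Subset n → Set
  Balanced U S A = A ⊆ U × ∣ S ∣ < 3 * ∣ S ∩ A ∣ × 3 * ∣ S ∩ A ∣ ≤ 2 * ∣ S ∣

  -- Dropping heads while the rest is heavy ends at a list whose tail is not heavy. Its light head
  -- and its tail together contain at most a third plus a third of `S`.
  accumulate : ∀ U S k As →
               All (λ A → A ⊆ U) As → All (λ A → ∣ ∂ U A ∣ ≤ k) As →
               All (λ A → 3 * ∣ S ∩ A ∣ ≤ ∣ S ∣) As → ∣ S ∣ < 3 * ∣ S ∩ ⋃ As ∣ →
               ∃ λ A → Balanced U S A × ∣ ∂ U A ∣ ≤ length As * k
  accumulate U S k [] _ _ _ heavy = contradiction
    (≤-trans heavy (*-monoʳ-≤ 3 (≤-trans (∣p∩q∣≤∣q∣ S ⊥) (≤-reflexive (∣⊥∣≡0 n))))) λ ()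
  accumulate U S k (A ∷ As) As⊆U@(_ ∷ As⊆U′) thin@(_ ∷ thin′) (light ∷ light′) heavy
    with ∣ S ∣ <? 3 * ∣ S ∩ ⋃ As ∣
  ... | yes heavy′ with accumulate U S k As As⊆U′ thin′ light′ heavy′
  ...   | B , balanced , ∂B≤ = B , balanced , ≤-trans ∂B≤ (m≤n+m _ k)
  accumulate U S k (A ∷ As) As⊆U thin (light ∷ _) heavy | no ¬heavy′ =
    ⋃ (A ∷ As) , (⋃⊆ (A ∷ As) As⊆U , heavy , (begin
      3 * ∣ S ∩ (A ∪ ⋃ As) ∣                ≤⟨ *-monoʳ-≤ 3 (∣S∩A∪B∣≤ S A (⋃ As)) ⟩
      3 * (∣ S ∩ A ∣ + ∣ S ∩ ⋃ As ∣)        ≡⟨ *-distribˡ-+ 3 ∣ S ∩ A ∣ _ ⟩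
      3 * ∣ S ∩ A ∣ + 3 * ∣ S ∩ ⋃ As ∣      ≤⟨ +-mono-≤ light (≮⇒≥ ¬heavy′) ⟩
      ∣ S ∣ + ∣ S ∣                         ≡⟨ cong (λ k → ∣ S ∣ + k) (+-identityʳ ∣ S ∣) ⟨
      2 * ∣ S ∣                             ∎)) , ∣∂⋃∣≤ U (A ∷ As) thin
    where open ≤-Reasoning

  -- The a layers outside the ball of radius a have at most 2ap/q vertices
  -- altogether, so one of them has at most b = ⌊2p/q⌋.
  thin-layer : ∀ U {u} → u ∈ U → ∀ a .{{_ : NonZero a}} →
               ∃ λ i → i < a × ∣ ∂ U (ball U u (a + i)) ∣ ≤ b
  thin-layer U {u} u∈U a = [ (λ x → x) , (λ big → contradiction (fits big) (<-irrefl refl)) ]′ (search a)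
    where
    open ≤-Reasoning
    search : ∀ k → (∃ λ i → i < k × ∣ ∂ U (ball U u (a + i)) ∣ ≤ b)
                   ⊎ k * suc b ≤ ∣ ball U u (a + k) ∣
    search zero = inj₂ z≤n
    search (suc k) with search k
    ... | inj₁ (i , i<k , thin) = inj₁ (i , m<n⇒m<1+n i<k , thin)
    ... | inj₂ big with ∣ ∂ U (ball U u (a + k)) ∣ ≤? b
    ...   | yes thin = inj₁ (k , ≤-refl , thin)
    ...   | no thick = inj₂ (begin
      suc b + k * suc b
        ≤⟨ +-mono-≤ (≰⇒> thick) big ⟩
      ∣ ∂ U (ball U u (a + k)) ∣ + ∣ ball U u (a + k) ∣
        ≡⟨ +-comm ∣ ∂ U (ball U u (a + k)) ∣ _ ⟩
      ∣ ball U u (a + k) ∣ + ∣ ∂ U (ball U u (a + k)) ∣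
        ≡⟨ ∣ball-suc∣ U u (a + k) ⟨
      ∣ ball U u (suc (a + k)) ∣
        ≡⟨ cong (λ r → ∣ ball U u r ∣) (+-suc a k) ⟨
      ∣ ball U u (a + suc k) ∣ ∎)
    fits : a * suc b ≤ ∣ ball U u (a + a) ∣ → suc b ≤ b
    fits big = m*n≤o⇒m≤o/n (suc b) q (2 * p) (*-cancelˡ-≤ a (begin
      a * (suc b * q)            ≡⟨ *-assoc a (suc b) q ⟨
      a * suc b * q              ≤⟨ *-monoˡ-≤ q big ⟩
      ∣ ball U u (a + a) ∣ * q   ≤⟨ linear U u (a + a) u∈U (≤-trans (>-nonZero⁻¹ a) (m≤m+n a a)) ⟩
      p * (a + a)                ≡⟨ eq p a ⟩
      a * (2 * p)                ∎))
      where
      eq : ∀ p a → p * (a + a) ≡ a * (2 * p)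
      eq = solve-∀

  -- A greedy choice: a vertex becomes a centre unless it is already within distance 2h of one. `C`
  -- is the union of the balls of radius `h` chosen so far; they are disjoint, which gives the
  -- count.
  packing : ∀ U {v} → v ∈ U → ∀ R h →
            (∀ x → x ∈ ball U v R → h < ∣ ball U x h ∣) →
            ∃ λ L → All (_∈ ball U v R) L
                  × (∀ x → x ∈ ball U v R → Any (λ u → x ∈ ball U u (h + h)) L)
                  × length L * suc h ≤ ∣ ball U v (R + h) ∣
  packing U {v} v∈U R h large with greedy (allFin n)
    where
    greedy : ∀ xs → ∃ λ L → All (_∈ ball U v R) L
             × (∀ {x} → x L.∈ xs → x ∈ ball U v R → Any (λ u → x ∈ ball U u (h + h)) L)
             × ∃ λ C → length L * suc h ≤ ∣ C ∣ × C ⊆ ball U v (R + h)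
                     × (∀ {y} → y ∈ C → Any (λ u → y ∈ ball U u h) L)
    greedy [] = [] , [] , (λ ()) , ⊥ , z≤n , (λ x∈ → contradiction x∈ ∉⊥) , (λ x∈ → contradiction x∈ ∉⊥)
    greedy (x ∷ xs) with greedy xs
    ... | L , L⊆ , covers , C , L≤C , C⊆ , close with x ∈? ball U v R | Any.any? (λ u → x ∈? ball U u (h + h)) L
    ...   | no x∉  | _ = L , L⊆ ,
      (λ { (here refl) x∈ → contradiction x∈ x∉ ; (there y∈) → covers y∈ }) , C , L≤C , C⊆ , close
    ...   | yes x∈ | yes covered = L , L⊆ ,
      (λ { (here refl) _ → covered ; (there y∈) → covers y∈ }) , C , L≤C , C⊆ , close
    ...   | yes x∈ | no ¬covered = x ∷ L , x∈ ∷ L⊆ ,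
      (λ { (here refl) _ → here (centre∈ball U x (h + h)) ; (there y∈) y∈b → there (covers y∈ y∈b) }) ,
      ball U x h ∪ C ,
      ≤-trans (+-mono-≤ (large x x∈) L≤C) (≤-reflexive (sym (disjoint⇒∣p∪q∣≡∣p∣+∣q∣ (ball U x h) C disjoint))) ,
      (λ y∈ → [ ball-trans U v R h x∈ , C⊆ ]′ (x∈p∪q⁻ (ball U x h) C y∈)) ,
      (λ y∈ → [ here , there ∘ close ]′ (x∈p∪q⁻ (ball U x h) C y∈))
      where
      x∈U : x ∈ U
      x∈U = ball⊆ U v∈U R x∈
      disjoint : ∀ {y} → y ∈ ball U x h → y ∉ C
      -- A common vertex would put `x` within distance `h + h` of a centre chosen before.
      disjoint y∈ y∈C = ¬covered (Any.map (λ {u} y∈u → ball-trans U u h h y∈u (ball-sym U h x∈U y∈)) (close y∈C))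
  ... | L , L⊆ , covers , C , L≤C , C⊆ , _ =
    L , L⊆ , (λ x → covers (∈-allFin x)) , ≤-trans L≤C (p⊆q⇒∣p∣≤∣q∣ C⊆)

  module _ (U S : Subset n) (S⊆U : S ⊆ U) (big : 12 * p ≤ ∣ S ∣ * q) where

    Light : ℕ → Set
    Light r = ∀ u → u ∈ U → 3 * ∣ S ∩ ball U u r ∣ ≤ ∣ S ∣

    12≤∣S∣ : 12 ≤ ∣ S ∣
    12≤∣S∣ = *-cancelʳ-≤ 12 ∣ S ∣ q (≤-trans (*-monoʳ-≤ 12 q≤p) big)

    light₀ : Light 0
    light₀ u _ = begin
      3 * ∣ S ∩ ⁅ u ⁆ ∣   ≤⟨ *-monoʳ-≤ 3 (∣p∩q∣≤∣q∣ S ⁅ u ⁆) ⟩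
      3 * ∣ ⁅ u ⁆ ∣       ≡⟨ cong (3 *_) (∣⁅x⁆∣≡1 u) ⟩
      3                   ≤⟨ ≤-trans (m≤m+n 3 9) 12≤∣S∣ ⟩
      ∣ S ∣               ∎
      where open ≤-Reasoning

    -- The bound `k` makes the search finite; it is applied with `k = n`, beyond which no ball
    -- grows.
    threshold : ∀ k → Light k ⊎ ∃ λ r → Light r × ∃ λ v → v ∈ U × ∣ S ∣ < 3 * ∣ S ∩ ball U v (suc r) ∣
    threshold zero = inj₁ light₀
    threshold (suc k) with threshold k
    ... | inj₂ found = inj₂ found
    ... | inj₁ light with Fin.any? (λ v → v ∈? U ×-dec ∣ S ∣ <? 3 * ∣ S ∩ ball U v (suc k) ∣)
    ...   | yes heavy = inj₂ (k , light , heavy)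
    ...   | no ¬heavy = inj₁ λ u u∈U → ≮⇒≥ λ heavy → ¬heavy (u , u∈U , heavy)

    -- A ball of radius `n` that could still grow would have more than `n` vertices, so these balls
    -- are components and have no outer neighbours. Repeated components do no harm, as each
    -- contributes 0 to the boundary.
    light-n : Light n → ∃ λ A → Balanced U S A × ∣ ∂ U A ∣ ≤ w
    light-n light = answer
      where
      B : Fin n → Subset n
      B u = ball U u n

      L : List (Fin n)
      L = List.filter (_∈? U) (allFin n)

      L⊆U : All (_∈ U) L
      L⊆U = All.all-filter (_∈? U) (allFin n)

      ∂B≤0 : ∀ u → ∣ ∂ U (B u) ∣ ≤ 0
      ∂B≤0 u with ball-closed-or-large U u n
      ... | inj₂ large  = contradiction large (≤⇒≯ (∣p∣≤n (B u)))
      ... | inj₁ closed = ≤-trans (p⊆q⇒∣p∣≤∣q∣ {q = ⊥} λ x∈ →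
        contradiction (closed (suc n) (x∈p∪q⁺ (inj₂ x∈))) (proj₂ (proj₂ (x∈∂⁻ U (B u) x∈))))
        (≤-reflexive (∣⊥∣≡0 n))

      cover : ∀ {x} → x ∈ S → x ∈ ⋃ (List.map B L)
      cover {x} x∈S = x∈⋃ (Any.map⁺ (L.lose (∈-filter⁺ (_∈? U) (∈-allFin x) (S⊆U x∈S)) (centre∈ball U x n)))

      answer : ∃ λ A → Balanced U S A × ∣ ∂ U A ∣ ≤ w
      answer with accumulate U S 0 (List.map B L)
        (All.map⁺ (All.map (λ u∈U {x} → ball⊆ U u∈U n {x}) L⊆U))
        (All.map⁺ (All.map (λ {u} _ → ∂B≤0 u) L⊆U))
        (All.map⁺ (All.map (λ {u} → light u) L⊆U))
        (<-≤-trans (m<m+n ∣ S ∣ (+-mono-≤ (≤-trans (m≤m+n 1 11) 12≤∣S∣) z≤n))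
          (*-monoʳ-≤ 3 (p⊆q⇒∣p∣≤∣q∣ λ x∈S → x∈p∩q⁺ (x∈S , cover x∈S))))
      ... | A , balanced , ∂A≤ = A , balanced ,
        ≤-trans ∂A≤ (≤-trans (≤-reflexive (*-zeroʳ (length (List.map B L)))) z≤n)

    -- Radii from 2h to 4h are large enough for the enlarged balls to cover the heavy ball and,
    -- being at most `r`, small enough for each of them to be light.
    transition : ∀ {r v} h → 1 ≤ h → h * 4 ≤ r → suc r ≤ 4 + h * 4 →
                 Light r → v ∈ U → ∣ S ∣ < 3 * ∣ S ∩ ball U v (suc r) ∣ →
                 ∃ λ A → Balanced U S A × ∣ ∂ U A ∣ ≤ w
    transition {r} {v} h 1≤h 4h≤r r<4h+4 light v∈U heavy = answer
      where
      open ≤-Reasoning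

      4h≤r′ : (h + h) + (h + h) ≤ r
      4h≤r′ = subst (_≤ r) (sym (eq h)) 4h≤r
        where
        eq : ∀ h → (h + h) + (h + h) ≡ h * 4
        eq = solve-∀

      not-closed : ∀ x → x ∈ ball U v (suc r) → h < ∣ ball U x h ∣
      not-closed x x∈ with ball-closed-or-large U x h
      ... | inj₂ large  = large
      -- If the ball around `x` had stopped growing, it would contain the heavy ball around `v`,
      -- which lies within distance 2(r + 1) of `x`. But its radius is h ≤ r, so it is light.
      ... | inj₁ closed = contradiction (≤-trans heavy (≤-trans (*-monoʳ-≤ 3 (p⊆q⇒∣p∣≤∣q∣ (∩-monoʳ S
          λ _ y∈ → ball-mono U x h≤r (closed (suc r + suc r)
            (ball-trans U x (suc r) (suc r) (ball-sym U (suc r) v∈U x∈) y∈)))))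
          (light x (ball⊆ U v∈U (suc r) x∈)))) (<-irrefl refl)
        where
        h≤r : h ≤ r
        h≤r = ≤-trans (m≤m*n h 4) 4h≤r

      pack : ∃ λ L → All (_∈ ball U v (suc r)) L
                   × (∀ x → x ∈ ball U v (suc r) → Any (λ u → x ∈ ball U u (h + h)) L)
                   × length L * suc h ≤ ∣ ball U v (suc r + h) ∣
      pack = packing U v∈U (suc r) h not-closed

      L : List (Fin n)
      L = proj₁ pack

      L⊆U : All (_∈ U) L
      L⊆U = All.map (ball⊆ U v∈U (suc r)) (proj₁ (proj₂ pack))

      -- The disjoint balls have at least h + 1 vertices each and lie in a ball of radius r + 1 + h
      -- ≤ 5(h + 1). This is the source of the 5 in `t`.
      ∣L∣≤t : length L ≤ t
      ∣L∣≤t = m*n≤o⇒m≤o/n (length L) q (5 * p) (*-cancelʳ-≤ (length L * q) (5 * p) (suc h) (begin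
        length L * q * suc h            ≡⟨ eq₁ (length L) q (suc h) ⟩
        length L * suc h * q            ≤⟨ *-monoˡ-≤ q (proj₂ (proj₂ (proj₂ pack))) ⟩
        ∣ ball U v (suc r + h) ∣ * q    ≤⟨ linear U v (suc r + h) v∈U (s≤s z≤n) ⟩
        p * (suc r + h)                 ≤⟨ *-monoʳ-≤ p (+-mono-≤ r<4h+4 (n≤1+n h)) ⟩
        p * ((4 + h * 4) + suc h)       ≡⟨ eq₂ p h ⟩
        5 * p * suc h                   ∎))
        where
        eq₁ : ∀ l q h → l * q * h ≡ l * h * q
        eq₁ = solve-∀
        eq₂ : ∀ p h → p * ((4 + h * 4) + suc h) ≡ 5 * p * suc h
        eq₂ = solve-∀

      radius : ∀ u → ∃ λ ρ → h + h ≤ ρ × ρ ≤ r × (u ∈ U → ∣ ∂ U (ball U u ρ) ∣ ≤ b)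
      radius u with u ∈? U
      -- A default value that makes `B` total; all centres in `L` lie in `U`.
      ... | no u∉U = h + h , ≤-refl , ≤-trans (m≤m+n (h + h) (h + h)) 4h≤r′ , λ u∈U → contradiction u∈U u∉U
      ... | yes u∈U with thin-layer U u∈U (h + h) {{>-nonZero (≤-trans 1≤h (m≤m+n h h))}}
      ...   | i , i< , thin = h + h + i , m≤m+n (h + h) i
                            , ≤-trans (+-monoʳ-≤ (h + h) (<⇒≤ i<)) 4h≤r′ , λ _ → thin

      B : Fin n → Subset n
      B u = ball U u (proj₁ (radius u))

      light-B : ∀ {u} → u ∈ U → 3 * ∣ S ∩ B u ∣ ≤ ∣ S ∣
      light-B {u} u∈U = ≤-trans (*-monoʳ-≤ 3 (p⊆q⇒∣p∣≤∣q∣ (∩-monoʳ S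
        λ _ → ball-mono U u (proj₁ (proj₂ (proj₂ (radius u))))))) (light u u∈U)

      heavy-⋃ : ∣ S ∣ < 3 * ∣ S ∩ ⋃ (List.map B L) ∣
      heavy-⋃ = <-≤-trans heavy (*-monoʳ-≤ 3 (p⊆q⇒∣p∣≤∣q∣ (∩-monoʳ S λ {x} _ x∈ →
        x∈⋃ (Any.map⁺ (Any.map (λ {u} → ball-mono U u (proj₁ (proj₂ (radius u))))
          (proj₁ (proj₂ (proj₂ pack)) x x∈))))))

      answer : ∃ λ A → Balanced U S A × ∣ ∂ U A ∣ ≤ w
      answer with accumulate U S b (List.map B L)
        (All.map⁺ (All.map (λ {u} u∈U {x} → ball⊆ U u∈U (proj₁ (radius u)) {x}) L⊆U))
        (All.map⁺ (All.map (λ {u} → proj₂ (proj₂ (proj₂ (radius u)))) L⊆U))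
        (All.map⁺ (All.map light-B L⊆U))
        heavy-⋃
      ... | A , balanced , ∂A≤ = A , balanced ,
        ≤-trans ∂A≤ (*-monoˡ-≤ b (≤-trans (≤-reflexive (length-map B L)) ∣L∣≤t))

    separator : ∃ λ A → Balanced U S A × ∣ ∂ U A ∣ ≤ w
    separator with threshold n
    ... | inj₁ light = light-n light
    ... | inj₂ (r , light , v , v∈U , heavy) =
      transition (r / 4) (m≥n⇒m/n>0 4≤r) (m/n*n≤m r 4) r<4h+4 light v∈U heavy
      where
      open ≤-Reasoning

      -- The heavy ball of radius r + 1 has more than |S|/3 ≥ 4c vertices, but at most c(r + 1). So
      -- the radius `r / 4` is positive.
      4≤r : 4 ≤ r
      4≤r = s≤s⁻¹ (*-cancelˡ-< (3 * p) 4 (suc r) (begin-strict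
        3 * p * 4                          ≡⟨ eq p ⟩
        12 * p                             ≤⟨ big ⟩
        ∣ S ∣ * q                          <⟨ *-monoˡ-< q (<-≤-trans heavy (*-monoʳ-≤ 3 (∣p∩q∣≤∣q∣ S _))) ⟩
        3 * ∣ ball U v (suc r) ∣ * q       ≡⟨ *-assoc 3 ∣ ball U v (suc r) ∣ q ⟩
        3 * (∣ ball U v (suc r) ∣ * q)     ≤⟨ *-monoʳ-≤ 3 (linear U v (suc r) v∈U (s≤s z≤n)) ⟩
        3 * (p * suc r)                    ≡⟨ *-assoc 3 p (suc r) ⟨
        3 * p * suc r                      ∎))
        where
        eq : ∀ p → 3 * p * 4 ≡ 12 * p
        eq = solve-∀

      r<4h+4 : suc r ≤ 4 + r / 4 * 4
      r<4h+4 = subst (_< 4 + r / 4 * 4) (sym (m≡m%n+[m/n]*n r 4)) (+-monoˡ-< (r / 4 * 4) (m%n<n r 4))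

-- Trees and embeddings into strong products

infixr 5 _++ʷ_

_++ʷ_ : ∀ {V : Set} {E : Rel V 0ℓ} {k l u v w} → Walk E k u v → Walk E l v w → Walk E (k + l) u w
[]      ++ʷ q = q
(e ∷ p) ++ʷ q = e ∷ (p ++ʷ q)

walk-map : ∀ {V W : Set} {E : Rel V 0ℓ} {F : Rel W 0ℓ} (f : V → W) → (∀ {u v} → E u v → F (f u) (f v)) →
           ∀ {k u v} → Walk E k u v → Walk F k (f u) (f v)
walk-map f f-mono []      = []
walk-map f f-mono (e ∷ p) = f-mono e ∷ walk-map f f-mono p

module _ {A : Set} where

  -- Vertices are words, the empty word is the root, and a child adds a letter at the end. Prefixing
  -- a fixed letter thus moves the whole tree to the subtree rooted at a child of the root.
  data Child : Rel (List A) 0ℓ where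
    here  : ∀ {a} → Child [] (a ∷ [])
    there : ∀ {a xs ys} → Child xs ys → Child (a ∷ xs) (a ∷ ys)

  length-Child : ∀ {xs ys} → Child xs ys → length ys ≡ suc (length xs)
  length-Child here      = refl
  length-Child (there c) = cong suc (length-Child c)

  parent-unique : ∀ {xs ys zs} → Child xs zs → Child ys zs → xs ≡ ys
  parent-unique here      here      = refl
  parent-unique (there c) (there d) = cong (_ ∷_) (parent-unique c d)

  Tree : Graph (List A)
  Adj Tree xs ys = Child xs ys ⊎ Child ys xs
  symm Tree = [ inj₂ , inj₁ ]′
  irrefl Tree = [ ¬loop , ¬loop ]′
    where
    ¬loop : ∀ {xs} → ¬ Child xs xs
    ¬loop c = 1+n≢n (sym (length-Child c))

  parent : ∀ {xs ys} → Adj Tree xs ys → length ys ≤ length xs → Child ys xs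
  parent (inj₂ c) _ = c
  parent (inj₁ c) ys≤xs = contradiction (subst (_≤ _) (length-Child c) ys≤xs) (<-irrefl refl)

  Adj-∷ : ∀ a {xs ys} → Adj Tree xs ys → Adj Tree (a ∷ xs) (a ∷ ys)
  Adj-∷ a = [ inj₁ ∘ there , inj₂ ∘ there ]′

  down : ∀ xs → ∃ λ k → Walk (Adj Tree) k [] xs
  down []       = 0 , []
  down (a ∷ xs) = _ , inj₁ here ∷ walk-map (a ∷_) (Adj-∷ a) (proj₂ (down xs))

  up : ∀ xs → ∃ λ k → Walk (Adj Tree) k xs []
  up []       = 0 , []
  up (a ∷ xs) = _ , (walk-map (a ∷_) (Adj-∷ a) (proj₂ (up xs)) ∷ʳ inj₂ here)

maximum : ∀ {n} (f : Fin (suc n) → ℕ) → ∃ λ i → ∀ j → f j ≤ f i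
maximum {zero} f = zero , λ { zero → ≤-refl }
maximum {suc n} f with maximum (f ∘ suc)
... | i , i-max with ≤-total (f zero) (f (suc i))
...   | inj₁ ≤i = suc i , λ { zero → ≤i ; (suc j) → i-max j }
...   | inj₂ i≤ = zero , λ { zero → ≤-refl ; (suc j) → ≤-trans (i-max j) i≤ }

cycle-neighbours : ∀ {V : Set} (G : Graph V) ((m , v , _) : Cycle G) (i : Fin (3 + m)) →
                   ∃₂ λ j k → j ≢ k × Adj G (v i) (v j) × Adj G (v i) (v k)
cycle-neighbours G (m , v , _ , step , close) zero =
  suc zero , fromℕ (2 + m) , (λ ()) , step zero , symm G close
cycle-neighbours G (m , v , _ , step , close) (suc i) with view i
... | ‵fromℕ = inject₁ (fromℕ (1 + m)) , zero , (λ ()) , symm G (step (fromℕ (1 + m))) , close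
... | ‵inject₁ j = inject₁ (inject₁ j) , suc (suc j) , distinct ,
  symm G (step (inject₁ j)) , step (suc j)
  where
  distinct : inject₁ (inject₁ j) ≢ suc (suc j)
  distinct eq = m≢1+n+m (toℕ j) {1} (trans (sym (trans (Fin.toℕ-inject₁ (inject₁ j)) (Fin.toℕ-inject₁ j)))
                                        (cong toℕ eq))

-- A deepest vertex of a cycle would have two distinct parents.
Tree-isTree : ∀ {A} → IsTree (Tree {A})
Tree-isTree .IsTree.nonempty = []
Tree-isTree .IsTree.connected xs ys = _ , proj₂ (up xs) ++ʷ proj₂ (down ys)
Tree-isTree .IsTree.acyclic cycle@(m , v , inj , _) with maximum (length ∘ v)
... | i , deepest with cycle-neighbours Tree cycle i
... | j , k , j≢k , ij , ik =
  j≢k (inj (parent-unique (parent ij (deepest j)) (parent ik (deepest k))))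

module _ {n k} {A : Set} (_≟_ : DecidableEquality A) (f : Fin n → A)
  (fibre≤ : ∀ x (P : Subset n) → (∀ {v} → v ∈ P → f v ≡ x) → ∣ P ∣ ≤ k) where

  private
    Earlier : Fin n → Pred (Fin n) 0ℓ
    Earlier v u = u Fin.< v × f u ≡ f v

    earlier? : ∀ v → Decidable (Earlier v)
    earlier? v u = u Fin.<? v ×-dec (f u ≟ f v)

    same? : ∀ v → Decidable (λ u → f u ≡ f v)
    same? v u = f u ≟ f v

    rank : Fin n → ℕ
    rank v = ∣ ⟪ earlier? v ⟫ ∣

    rank<k : ∀ v → rank v < k
    rank<k v = <-≤-trans (p⊂q⇒∣p∣<∣q∣
      ( (λ u∈ → x∈⟪⟫⁺ (same? v) (proj₂ (x∈⟪⟫⁻ (earlier? v) u∈)))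
      , v , x∈⟪⟫⁺ (same? v) refl , λ v∈ → <-irrefl refl (proj₁ (x∈⟪⟫⁻ (earlier? v) v∈))))
      (fibre≤ (f v) _ (x∈⟪⟫⁻ (same? v)))

    rank-mono : ∀ {u v} → f u ≡ f v → u Fin.< v → rank u < rank v
    rank-mono {u} {v} eq u<v = p⊂q⇒∣p∣<∣q∣
      ( (λ w∈ → let w<u , fw≡fu = x∈⟪⟫⁻ (earlier? u) w∈ in
                x∈⟪⟫⁺ (earlier? v) (<-trans w<u u<v , trans fw≡fu eq))
      , u , x∈⟪⟫⁺ (earlier? v) (u<v , eq) , λ u∈ → <-irrefl refl (proj₁ (x∈⟪⟫⁻ (earlier? u) u∈)))

  -- Numbers each fibre of `f` in the order of `Fin n`. The earlier members of a fibre form a proper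
  -- subset of it, as `v` itself is missing, so the rank is below `k`.
  index : Fin n → Fin k
  index v = fromℕ< (rank<k v)

  index-injective : ∀ {u v} → f u ≡ f v → index u ≡ index v → u ≡ v
  index-injective {u} {v} eq iu≡iv with Fin.<-cmp u v | Fin.fromℕ<-injective _ _ (rank<k u) (rank<k v) iu≡iv
  ... | tri≈ _ u≡v _ | _ = u≡v
  ... | tri< u<v _ _ | r = contradiction (rank-mono eq u<v) (<-irrefl r)
  ... | tri> _ _ v<u | r = contradiction (rank-mono (sym eq) v<u) (<-irrefl (sym r))

  -- The subgraph is the image of `G` under `φ`, which pairs the bag with the index inside it.
  -- Adjacent vertices in one bag have different indices because `G` has no loops.
  partition⇒embedding : (T : Graph A) (G : Graph (Fin n)) →
    (∀ {u v} → Adj G u v → f u ≡ f v ⊎ Adj T (f u) (f v)) → IsomorphicToSubgraph G (T ⊠ K k)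
  partition⇒embedding T G respects =
    (λ w → ∃ λ v → φ v ≡ w) ,
    (λ w w′ → ∃₂ λ u v → φ u ≡ w × φ v ≡ w′ × Adj G u v) ,
    record { edge⇒adj = λ { _ _ (u , v , refl , refl , uv) → φ-adj uv }
           ; edge⇒end = λ { _ _ (u , v , eq , eq′ , _) → (u , eq) , (v , eq′) }
           ; edge-sym = λ { _ _ (u , v , eq , eq′ , uv) → v , u , eq′ , eq , symm G uv } } ,
    φ ,
    record { injective = φ-injective
           ; image = λ w → mk⇔ (λ x → x) (λ x → x)
           ; edges = λ u v → mk⇔ (λ uv → u , v , refl , refl , uv)
               λ { (u′ , v′ , eq , eq′ , uv) → subst₂ (Adj G) (φ-injective eq) (φ-injective eq′) uv } }
    where
    φ : Fin n → A × Fin k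
    φ v = f v , index v

    φ-injective : ∀ {u v} → φ u ≡ φ v → u ≡ v
    φ-injective eq = index-injective (cong proj₁ eq) (cong proj₂ eq)

    φ-adj : ∀ {u v} → Adj G u v → Adj (T ⊠ K k) (φ u) (φ v)
    φ-adj {u} {v} uv with respects uv | index u Fin.≟ index v
    ... | inj₁ eq | iu≟iv = inj₂ (inj₁ (eq , λ iu≡iv →
      irrefl G (subst (Adj G u) (sym (index-injective eq iu≡iv)) uv)))
    ... | inj₂ adj | yes eq = inj₁ (adj , eq)
    ... | inj₂ adj | no neq = inj₂ (inj₂ (adj , neq))

-- Tree-partitions

-- The letters are bit strings, so that gluing can separate two families of children by one more
-- leading bit.
Node : Set
Node = List (List Bool)

Near : Node → Node → Set
Near x y = x ≡ y ⊎ Adj Tree x y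

-- Moves the subtrees below the root to labels starting with s, so that two
-- trees can be glued along their roots.
tag : Bool → Node → Node
tag s []       = []
tag s (l ∷ ls) = (s ∷ l) ∷ ls

tag-[] : ∀ s {x} → tag s x ≡ [] → x ≡ []
tag-[] s {[]} refl = refl

tag-∷ : ∀ {s s′ x l ls} → tag s x ≡ (s′ ∷ l) ∷ ls → s ≡ s′ × x ≡ l ∷ ls
tag-∷ {x = l ∷ ls} refl = refl , refl

tag-Near : ∀ s {x y} → Near x y → Near (tag s x) (tag s y)
tag-Near s = Sum.map (cong (tag s)) (Sum.map tag-Child tag-Child)
  where
  tag-Child : ∀ {x y} → Child x y → Child (tag s x) (tag s y)
  tag-Child here      = here
  tag-Child (there c) = there c

Near-sym : ∀ {x y} → Near x y → Near y x
Near-sym = Sum.map sym (symm Tree)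

-- Adding the two bounds gives 4w twice on the left, while doubling the overlap 2w gives 4w once on
-- the right; one copy survives the cancellation.
glued-root : ∀ {a b c d m} → a + c ≤ 2 * m → b + c ≤ 2 * d → ∀ {M w} → c ≡ 4 * w → m + d ≤ M + 2 * w →
         a + b + c ≤ 2 * M
glued-root {a} {b} {c} {d} {m} h₁ h₂ {M} {w} refl h = +-cancelʳ-≤ (4 * w) (a + b + 4 * w) (2 * M) (begin
  a + b + 4 * w + 4 * w          ≡⟨ eq a b (4 * w) ⟩
  (a + 4 * w) + (b + 4 * w)      ≤⟨ +-mono-≤ h₁ h₂ ⟩
  2 * m + 2 * d                  ≡⟨ *-distribˡ-+ 2 m d ⟨
  2 * (m + d)                    ≤⟨ *-monoʳ-≤ 2 h ⟩
  2 * (M + 2 * w)                ≡⟨ eq′ M w ⟩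
  2 * M + 4 * w                  ∎)
  where
  open ≤-Reasoning
  eq : ∀ a b c → a + b + c + c ≡ (a + c) + (b + c)
  eq = solve-∀
  eq′ : ∀ M w → 2 * (M + 2 * w) ≡ 2 * M + 4 * w
  eq′ = solve-∀

-- Here `x` and `y` are the sizes of the parts of `S` inside and outside a balanced set. Both are at
-- least m/3, which exceeds 4w.
balanced-sizes : ∀ {m x y w} → x + y ≡ m → m < 3 * x → 3 * x ≤ 2 * m → 12 * w < m → 4 * w < x × 4 * w < y
balanced-sizes {m} {x} {y} {w} refl m<3x 3x≤2m 12w<m =
  third x (<-trans 12w<m m<3x) , third y (<-≤-trans 12w<m (+-cancelˡ-≤ (2 * m) m (3 * y) (begin
    2 * m + m          ≡⟨ eq x y ⟩
    3 * x + 3 * y      ≤⟨ +-monoˡ-≤ (3 * y) 3x≤2m ⟩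
    2 * m + 3 * y      ∎)))
  where
  open ≤-Reasoning
  eq : ∀ x y → 2 * (x + y) + (x + y) ≡ 3 * x + 3 * y
  eq = solve-∀
  third : ∀ z → 12 * w < 3 * z → 4 * w < z
  third z 12w<3z = *-cancelˡ-< 3 (4 * w) z (subst (_< 3 * z) (*-assoc 3 4 w) 12w<3z)

module Partition {n} (G : FiniteGraph n) (p q : ℕ) .{{_ : NonZero q}} (q≤p : q ≤ p)
  (linear : ∀ U u r → u ∈ U → 1 ≤ r → ∣ Balls.ball G U u r ∣ * q ≤ p * r) where

  open Balls G
  open Separation G p q q≤p linear

  -- `d` bounds a ball of radius 1, and so `D` bounds the boundary of a set of at most 12w vertices.
  -- Prescribed sets never exceed `D`.
  d D : ℕ
  d = p / q
  D = 12 * w * d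

  -- A tree-partition of G[U] with S in the root bag.  The term 4w makes the
  -- bound on the root bag survive gluing two root bags along a separator with
  -- at most w vertices, which is counted twice in the bounds M on the two sides.
  record TreePartition (U S : Subset n) (M : ℕ) : Set where
    field
      bag       : Fin n → Node
      respects  : ∀ {u v} → u ∈ U → v ∈ U → Adj (graph G) u v → Near (bag u) (bag v)
      root⊇     : ∀ {v} → v ∈ S → bag v ≡ []
      root-size : ∀ P → (∀ {v} → v ∈ P → v ∈ U × bag v ≡ []) → ∣ P ∣ + 4 * w ≤ 2 * M
      width     : ∀ x P → (∀ {v} → v ∈ P → v ∈ U × bag v ≡ x) → ∣ P ∣ ≤ 2 * D
  open TreePartition

  restrict-root : ∀ {U S S′ M} → S ⊆ S′ → TreePartition U S′ M → TreePartition U S M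
  restrict-root S⊆S′ T = record
    { bag = bag T ; respects = respects T ; root⊇ = λ v∈S → root⊇ T (S⊆S′ v∈S)
    ; root-size = root-size T ; width = width T }

  -- `S` becomes the root bag, and the root of the given partition becomes its child with label
  -- `[]`. Edges leaving `S` end in `∂ U S`, which lies in the bag of that child.
  extend : ∀ {U S M M′} → ∣ S ∣ + 4 * w ≤ 2 * M → ∣ S ∣ ≤ 2 * D →
           TreePartition (U ─ S) (∂ U S) M′ → TreePartition U S M
  extend {U} {S} root≤ S≤ T = record
    { bag = β
    ; respects = respects′
    ; root⊇ = λ v∈S → β-in v∈S
    ; root-size = λ P h → ≤-trans (+-monoˡ-≤ (4 * w) (p⊆q⇒∣p∣≤∣q∣ λ v∈P → β-root (proj₂ (h v∈P)))) root≤
    ; width = width′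
    }
    where
    β : Fin n → Node
    β v = if does (v ∈? S) then [] else [] ∷ bag T v

    β-in : ∀ {v} → v ∈ S → β v ≡ []
    β-in {v} v∈S = cong (if_then [] else [] ∷ bag T v) (dec-true (v ∈? S) v∈S)

    β-out : ∀ {v} → v ∉ S → β v ≡ [] ∷ bag T v
    β-out {v} v∉S = cong (if_then [] else [] ∷ bag T v) (dec-false (v ∈? S) v∉S)

    β-root : ∀ {v} → β v ≡ [] → v ∈ S
    β-root {v} eq with v ∈? S
    ... | yes v∈S = v∈S
    ... | no _ with () ← eq

    crossing : ∀ {u v} → v ∈ U → Adj (graph G) u v → u ∈ S → v ∉ S → Near (β u) (β v)
    crossing v∈U uv u∈S v∉S = subst₂ Near (sym (β-in u∈S))
      (sym (trans (β-out v∉S) (cong ([] ∷_) (root⊇ T (x∈∂⁺ u∈S uv v∈U v∉S))))) (inj₂ (inj₁ here))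

    respects′ : ∀ {u v} → u ∈ U → v ∈ U → Adj (graph G) u v → Near (β u) (β v)
    respects′ {u} {v} u∈U v∈U uv = case (u ∈? S) of λ where
      (yes u∈S) → case (v ∈? S) of λ where
        (yes v∈S) → inj₁ (trans (β-in u∈S) (sym (β-in v∈S)))
        (no v∉S) → crossing v∈U uv u∈S v∉S
      (no u∉S) → case (v ∈? S) of λ where
        (yes v∈S) → Near-sym (crossing u∈U (symm (graph G) uv) v∈S u∉S)
        (no v∉S) → subst₂ Near (sym (β-out u∉S)) (sym (β-out v∉S))
          (Sum.map (cong ([] ∷_)) (Adj-∷ [])
            (respects T (x∈p∧x∉q⇒x∈p─q u∈U u∉S) (x∈p∧x∉q⇒x∈p─q v∈U v∉S) uv))

    width′ : ∀ x P → (∀ {v} → v ∈ P → v ∈ U × β v ≡ x) → ∣ P ∣ ≤ 2 * D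
    width′ [] P h = ≤-trans (p⊆q⇒∣p∣≤∣q∣ λ v∈P → β-root (proj₂ (h v∈P))) S≤
    width′ (l ∷ ls) P h = width T ls P λ {v} v∈P →
      let v∈U , eq = h v∈P
          v∉S = λ v∈S → case trans (sym (β-in v∈S)) eq of λ ()
      in x∈p∧x∉q⇒x∈p─q v∈U v∉S , ∷-injectiveʳ (trans (sym (β-out v∉S)) eq)

  -- The outer neighbours of `A` are in both root bags, so the two partitions agree on them once the
  -- roots are identified. Edges leaving `A` can therefore be checked in `T₁`.
  glue : ∀ {U S A M M₁ M₂} → A ⊆ U → M₁ + M₂ ≤ M + 2 * w → M ≤ D →
         TreePartition (A ∪ ∂ U A) (S ∩ A ∪ ∂ U A) M₁ →
         TreePartition (U ─ A) ((S ─ A) ∪ ∂ U A) M₂ → TreePartition U S M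
  glue {U} {S} {A} {M} {M₁} {M₂} A⊆U M₁+M₂≤ M≤D T₁ T₂ = record
    { bag = β
    ; respects = respects′
    ; root⊇ = root⊇′
    ; root-size = root-size′
    ; width = width′
    }
    where
    β : Fin n → Node
    β v = if does (v ∈? A) then tag true (bag T₁ v) else tag false (bag T₂ v)

    β-in : ∀ {v} → v ∈ A → β v ≡ tag true (bag T₁ v)
    β-in {v} v∈A = cong (if_then tag true (bag T₁ v) else tag false (bag T₂ v)) (dec-true (v ∈? A) v∈A)

    β-out : ∀ {v} → v ∉ A → β v ≡ tag false (bag T₂ v)
    β-out {v} v∉A = cong (if_then tag true (bag T₁ v) else tag false (bag T₂ v)) (dec-false (v ∈? A) v∉A)

    β-∂ : ∀ {v} → v ∈ ∂ U A → β v ≡ tag true (bag T₁ v)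
    β-∂ v∈∂ = trans (β-out (proj₂ (proj₂ (x∈∂⁻ U A v∈∂))))
      (trans (cong (tag false) (root⊇ T₂ (x∈p∪q⁺ (inj₂ v∈∂))))
        (cong (tag true) (sym (root⊇ T₁ (x∈p∪q⁺ (inj₂ v∈∂))))))

    crossing : ∀ {u v} → v ∈ U → Adj (graph G) u v → u ∈ A → v ∉ A → Near (β u) (β v)
    crossing v∈U uv u∈A v∉A = subst₂ Near (sym (β-in u∈A)) (sym (β-∂ v∈∂))
      (tag-Near true (respects T₁ (x∈p∪q⁺ (inj₁ u∈A)) (x∈p∪q⁺ (inj₂ v∈∂)) uv))
      where
      v∈∂ : _ ∈ ∂ U A
      v∈∂ = x∈∂⁺ u∈A uv v∈U v∉A

    respects′ : ∀ {u v} → u ∈ U → v ∈ U → Adj (graph G) u v → Near (β u) (β v)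
    respects′ {u} {v} u∈U v∈U uv = case (u ∈? A) of λ where
      (yes u∈A) → case (v ∈? A) of λ where
        (yes v∈A) → subst₂ Near (sym (β-in u∈A)) (sym (β-in v∈A))
          (tag-Near true (respects T₁ (x∈p∪q⁺ (inj₁ u∈A)) (x∈p∪q⁺ (inj₁ v∈A)) uv))
        (no v∉A) → crossing v∈U uv u∈A v∉A
      (no u∉A) → case (v ∈? A) of λ where
        (yes v∈A) → Near-sym (crossing u∈U (symm (graph G) uv) v∈A u∉A)
        (no v∉A) → subst₂ Near (sym (β-out u∉A)) (sym (β-out v∉A))
          (tag-Near false (respects T₂ (x∈p∧x∉q⇒x∈p─q u∈U u∉A) (x∈p∧x∉q⇒x∈p─q v∈U v∉A) uv))

    root⊇′ : ∀ {v} → v ∈ S → β v ≡ []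
    root⊇′ {v} v∈S = case (v ∈? A) of λ where
      (yes v∈A) → trans (β-in v∈A) (cong (tag true) (root⊇ T₁ (x∈p∪q⁺ (inj₁ (x∈p∩q⁺ (v∈S , v∈A))))))
      (no v∉A) → trans (β-out v∉A) (cong (tag false) (root⊇ T₂ (x∈p∪q⁺ (inj₁ (x∈p∧x∉q⇒x∈p─q v∈S v∉A)))))

    root-size′ : ∀ P → (∀ {v} → v ∈ P → v ∈ U × β v ≡ []) → ∣ P ∣ + 4 * w ≤ 2 * M
    root-size′ P h = subst (λ k → k + 4 * w ≤ 2 * M) (∣p∩q∣+∣p─q∣≡∣p∣ P A)
      (glued-root {∣ P ∩ A ∣} {∣ P ─ A ∣} {d = M₂} {M₁}
        (root-size T₁ (P ∩ A) (λ v∈ → let v∈P , v∈A = x∈p∩q⁻ P A v∈ in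
          x∈p∪q⁺ (inj₁ v∈A) , tag-[] true (trans (sym (β-in v∈A)) (proj₂ (h v∈P)))))
        (root-size T₂ (P ─ A) (λ v∈ → let v∈P , v∉A = x∈p─q⁻ P A v∈ in
          x∈p∧x∉q⇒x∈p─q (proj₁ (h v∈P)) v∉A , tag-[] false (trans (sym (β-out v∉A)) (proj₂ (h v∈P)))))
        {M} {w} refl M₁+M₂≤)

    width′ : ∀ x P → (∀ {v} → v ∈ P → v ∈ U × β v ≡ x) → ∣ P ∣ ≤ 2 * D
    -- The root is the only node shared by the two sides, so its bound comes from `root-size` and
    -- not from `width`.
    width′ [] P h = ≤-trans (m≤m+n ∣ P ∣ (4 * w)) (≤-trans (root-size′ P h) (*-monoʳ-≤ 2 M≤D))
    -- `tag` puts a bit in front of the first label, so no bag is at such a node: `P` is empty and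
    -- any width bound serves.
    width′ ([] ∷ ls) P h = width T₁ [] P λ {v} v∈P → contradiction (proj₂ (h v∈P)) (β-label v)
      where
      tag-label : ∀ s x → tag s x ≢ [] ∷ ls
      tag-label s [] ()
      tag-label s (_ ∷ _) ()
      β-label : ∀ v → β v ≢ [] ∷ ls
      β-label v with does (v ∈? A)
      ... | true  = tag-label true (bag T₁ v)
      ... | false = tag-label false (bag T₂ v)
    width′ ((true ∷ l) ∷ ls) P h = width T₁ (l ∷ ls) P λ {v} v∈P →
      let v∈U , eq = h v∈P in case (v ∈? A) of λ where
        (yes v∈A) → x∈p∪q⁺ (inj₁ v∈A) , proj₂ (tag-∷ (trans (sym (β-in v∈A)) eq))
        (no v∉A)  → case proj₁ (tag-∷ (trans (sym (β-out v∉A)) eq)) of λ ()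
    width′ ((false ∷ l) ∷ ls) P h = width T₂ (l ∷ ls) P λ {v} v∈P →
      let v∈U , eq = h v∈P in case (v ∈? A) of λ where
        (yes v∈A) → case proj₁ (tag-∷ (trans (sym (β-in v∈A)) eq)) of λ ()
        (no v∉A)  → x∈p∧x∉q⇒x∈p─q v∈U v∉A , proj₂ (tag-∷ (trans (sym (β-out v∉A)) eq))

  ∣∂∣≤ : ∀ U S → S ⊆ U → ∣ ∂ U S ∣ ≤ ∣ S ∣ * d
  ∣∂∣≤ U S S⊆U = ≤-trans (p⊆q⇒∣p∣≤∣q∣ ∂⊆⋃) (∣⋃∣≤ S (λ u → ball U u 1) λ u u∈S →
    m*n≤o⇒m≤o/n _ q p (subst (∣ ball U u 1 ∣ * q ≤_) (*-identityʳ p) (linear U u 1 (S⊆U u∈S) ≤-refl)))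
    where
    ∂⊆⋃ : ∂ U S ⊆ ⋃[ S ] (λ u → ball U u 1)
    ∂⊆⋃ x∈ with x∈∂⁻ U S x∈
    ... | (a , a∈S , ax) , x∈U , _ = x∈⋃⁺ (λ u → ball U u 1) a∈S (ball-step U a 0 (x∈⁅x⁆ a) ax x∈U)

  1≤d : 1 ≤ d
  1≤d = m≥n⇒m/n>0 q≤p

  -- Holds because ⌊2c⌋ > 2c - 1 ≥ c and ⌊5c⌋ ≥ 1. It turns |S| > 12w into the hypothesis |S| ≥ 12c
  -- of `separator`.
  p≤w*q : p ≤ w * q
  p≤w*q = begin
    p                 ≤⟨ +-cancelˡ-≤ q p (b * q) (begin
      q + p             ≤⟨ +-monoˡ-≤ p q≤p ⟩
      p + p             ≡⟨ cong (λ k → p + k) (+-identityʳ p) ⟨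
      2 * p             ≤⟨ <⇒≤ (m<n+[m/n]*n (2 * p) q) ⟩
      q + b * q         ∎) ⟩
    b * q             ≤⟨ m≤n*m (b * q) t {{>-nonZero (m≥n⇒m/n>0 (≤-trans q≤p (m≤n*m p 5)))}} ⟩
    t * (b * q)       ≡⟨ *-assoc t b q ⟨
    w * q             ∎
    where
    open ≤-Reasoning
    m<n+[m/n]*n : ∀ m n .{{_ : NonZero n}} → m < n + m / n * n
    m<n+[m/n]*n m n = subst (_< n + m / n * n) (sym (m≡m%n+[m/n]*n m n)) (+-monoˡ-< (m / n * n) (m%n<n m n))

  1≤w : 1 ≤ w
  1≤w = *-cancelʳ-≤ 1 w q (≤-trans (≤-reflexive (*-identityˡ q)) (≤-trans q≤p p≤w*q))

  4w≤D : 4 * w ≤ D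
  4w≤D = ≤-trans (*-monoˡ-≤ w (m≤m+n 4 8)) (m≤m*n (12 * w) d {{>-nonZero 1≤d}})

  -- The induction is on a bound for |U|. `M` is separate from |S|, which may be below 4w, because
  -- the root bound must leave room for the extra 4w.
  Builder : ℕ → Set
  Builder fuel = ∀ U S M → ∣ U ∣ ≤ fuel → S ⊆ U → ∣ S ∣ ≤ M → 4 * w ≤ M → M ≤ D → TreePartition U S M

  -- As `S` is nonempty, `U ─ S` is smaller than `U`. The next prescribed set has at most 12w * d
  -- vertices, so the recursive call takes `D` for `M`.
  build-small : ∀ {fuel} → Builder fuel → ∀ U S M → ∣ U ∣ ≤ suc fuel → S ⊆ U → ∣ S ∣ ≤ M →
                4 * w ≤ M → M ≤ D → Nonempty S → ∣ S ∣ ≤ 12 * w → TreePartition U S M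
  build-small rec U S M U≤ S⊆U S≤M 4w≤M M≤D (x , x∈S) S≤12w =
    extend (≤-trans (+-mono-≤ S≤M 4w≤M) (≤-reflexive (cong (λ k → M + k) (sym (+-identityʳ M)))))
      (≤-trans S≤M (≤-trans M≤D (m≤m+n D _)))
      (rec (U ─ S) (∂ U S) D
        (s≤s⁻¹ (≤-trans (p∩q≢∅⇒∣p─q∣<∣p∣ U S (x , x∈p∩q⁺ (S⊆U x∈S , x∈S))) U≤))
        (λ v∈∂ → let _ , v∈U , v∉S = x∈∂⁻ U S v∈∂ in x∈p∧x∉q⇒x∈p─q v∈U v∉S)
        (≤-trans (∣∂∣≤ U S S⊆U) (*-monoˡ-≤ d S≤12w))
        4w≤D ≤-refl)

  -- `A` and its complement each contain more than 4w vertices of `S`, while the separator has at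
  -- most w. So both sides are smaller than `U`, and neither prescribed set is larger than `S`. The
  -- separator joins both of them, whence the 2w.
  build-large : ∀ {fuel} → Builder fuel → ∀ U S M → ∣ U ∣ ≤ suc fuel → S ⊆ U → ∣ S ∣ ≤ M → M ≤ D →
                12 * w < ∣ S ∣ → (∃ λ A → Balanced U S A × ∣ ∂ U A ∣ ≤ w) → TreePartition U S M
  build-large rec U S M U≤ S⊆U S≤M M≤D 12w<S (A , (A⊆U , S<3 , 3≤2S) , ∂≤w) = glue A⊆U M₁+M₂≤ M≤D
    (rec (A ∪ ∂ U A) (S ∩ A ∪ ∂ U A) ∣ S ∩ A ∪ ∂ U A ∣
      (s≤s⁻¹ (≤-trans U₁<U U≤)) S₁⊆U₁ ≤-refl
      (≤-trans (<⇒≤ (proj₁ sizes)) (∣p∣≤∣p∪q∣ (S ∩ A) (∂ U A))) (≤-trans S₁≤ (≤-trans S≤M M≤D)))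
    (rec (U ─ A) ((S ─ A) ∪ ∂ U A) ∣ (S ─ A) ∪ ∂ U A ∣
      (s≤s⁻¹ (≤-trans U₂<U U≤)) S₂⊆U₂ ≤-refl
      (≤-trans (<⇒≤ (proj₂ sizes)) (∣p∣≤∣p∪q∣ (S ─ A) (∂ U A))) (≤-trans S₂≤ (≤-trans S≤M M≤D)))
    where
    open ≤-Reasoning

    sizes : 4 * w < ∣ S ∩ A ∣ × 4 * w < ∣ S ─ A ∣
    sizes = balanced-sizes {w = w} (∣p∩q∣+∣p─q∣≡∣p∣ S A) S<3 3≤2S 12w<S

    w≤4w : w ≤ 4 * w
    w≤4w = m≤n*m w 4

    ∣∪∂∣≤ : ∀ X → ∣ X ∪ ∂ U A ∣ ≤ ∣ X ∣ + w
    ∣∪∂∣≤ X = ≤-trans (∣p∪q∣≤∣p∣+∣q∣ X (∂ U A)) (+-monoʳ-≤ ∣ X ∣ ∂≤w)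

    S₁≤ : ∣ S ∩ A ∪ ∂ U A ∣ ≤ ∣ S ∣
    S₁≤ = begin
      ∣ S ∩ A ∪ ∂ U A ∣         ≤⟨ ∣∪∂∣≤ (S ∩ A) ⟩
      ∣ S ∩ A ∣ + w             ≤⟨ +-monoʳ-≤ ∣ S ∩ A ∣ (≤-trans w≤4w (<⇒≤ (proj₂ sizes))) ⟩
      ∣ S ∩ A ∣ + ∣ S ─ A ∣     ≡⟨ ∣p∩q∣+∣p─q∣≡∣p∣ S A ⟩
      ∣ S ∣                     ∎

    S₂≤ : ∣ (S ─ A) ∪ ∂ U A ∣ ≤ ∣ S ∣
    S₂≤ = begin
      ∣ (S ─ A) ∪ ∂ U A ∣       ≤⟨ ∣∪∂∣≤ (S ─ A) ⟩
      ∣ S ─ A ∣ + w             ≤⟨ +-monoʳ-≤ ∣ S ─ A ∣ (≤-trans w≤4w (<⇒≤ (proj₁ sizes))) ⟩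
      ∣ S ─ A ∣ + ∣ S ∩ A ∣     ≡⟨ +-comm ∣ S ─ A ∣ _ ⟩
      ∣ S ∩ A ∣ + ∣ S ─ A ∣     ≡⟨ ∣p∩q∣+∣p─q∣≡∣p∣ S A ⟩
      ∣ S ∣                     ∎

    M₁+M₂≤ : ∣ S ∩ A ∪ ∂ U A ∣ + ∣ (S ─ A) ∪ ∂ U A ∣ ≤ M + 2 * w
    M₁+M₂≤ = begin
      ∣ S ∩ A ∪ ∂ U A ∣ + ∣ (S ─ A) ∪ ∂ U A ∣   ≤⟨ +-mono-≤ (∣∪∂∣≤ (S ∩ A)) (∣∪∂∣≤ (S ─ A)) ⟩
      (∣ S ∩ A ∣ + w) + (∣ S ─ A ∣ + w)         ≡⟨ eq ∣ S ∩ A ∣ ∣ S ─ A ∣ w ⟩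
      (∣ S ∩ A ∣ + ∣ S ─ A ∣) + 2 * w           ≡⟨ cong (_+ 2 * w) (∣p∩q∣+∣p─q∣≡∣p∣ S A) ⟩
      ∣ S ∣ + 2 * w                             ≤⟨ +-monoˡ-≤ (2 * w) S≤M ⟩
      M + 2 * w                                 ∎
      where
      eq : ∀ x y w → (x + w) + (y + w) ≡ (x + y) + 2 * w
      eq = solve-∀

    U₁<U : ∣ A ∪ ∂ U A ∣ < ∣ U ∣
    U₁<U = begin-strict
      ∣ A ∪ ∂ U A ∣             ≤⟨ ∣∪∂∣≤ A ⟩
      ∣ A ∣ + w                 ≤⟨ +-monoʳ-≤ ∣ A ∣ w≤4w ⟩
      ∣ A ∣ + 4 * w             <⟨ +-monoʳ-< ∣ A ∣ (proj₂ sizes) ⟩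
      ∣ A ∣ + ∣ S ─ A ∣         ≤⟨ +-mono-≤ (p⊆q⇒∣p∣≤∣q∣ λ v∈A → x∈p∩q⁺ (A⊆U v∈A , v∈A))
                                    (p⊆q⇒∣p∣≤∣q∣ λ v∈ → let v∈S , v∉A = x∈p─q⁻ S A v∈ in
                                                        x∈p∧x∉q⇒x∈p─q (S⊆U v∈S) v∉A) ⟩
      ∣ U ∩ A ∣ + ∣ U ─ A ∣     ≡⟨ ∣p∩q∣+∣p─q∣≡∣p∣ U A ⟩
      ∣ U ∣                     ∎

    U₂<U : ∣ U ─ A ∣ < ∣ U ∣
    U₂<U = begin-strict
      ∣ U ─ A ∣                 <⟨ m<n+m ∣ U ─ A ∣ (≤-<-trans z≤n (<-≤-trans (proj₁ sizes)
                                    (p⊆q⇒∣p∣≤∣q∣ λ v∈ → let v∈S , v∈A = x∈p∩q⁻ S A v∈ in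
                                                        x∈p∩q⁺ (S⊆U v∈S , v∈A)))) ⟩
      ∣ U ∩ A ∣ + ∣ U ─ A ∣     ≡⟨ ∣p∩q∣+∣p─q∣≡∣p∣ U A ⟩
      ∣ U ∣                     ∎

    S₁⊆U₁ : S ∩ A ∪ ∂ U A ⊆ A ∪ ∂ U A
    S₁⊆U₁ v∈ = x∈p∪q⁺ (Sum.map₁ (λ v∈∩ → proj₂ (x∈p∩q⁻ S A v∈∩)) (x∈p∪q⁻ (S ∩ A) (∂ U A) v∈))

    S₂⊆U₂ : (S ─ A) ∪ ∂ U A ⊆ U ─ A
    S₂⊆U₂ v∈ with x∈p∪q⁻ (S ─ A) (∂ U A) v∈
    ... | inj₁ v∈─ = let v∈S , v∉A = x∈p─q⁻ S A v∈─ in x∈p∧x∉q⇒x∈p─q (S⊆U v∈S) v∉A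
    ... | inj₂ v∈∂ = let _ , v∈U , v∉A = x∈∂⁻ U A v∈∂ in x∈p∧x∉q⇒x∈p─q v∈U v∉A

  build : ∀ fuel → Builder fuel
  build fuel U S M U≤ S⊆U S≤M 4w≤M M≤D with nonempty? U
  ... | no empty = record
    { bag = λ _ → []
    ; respects = λ _ _ _ → inj₁ refl
    ; root⊇ = λ _ → refl
    ; root-size = λ P h → ≤-trans (+-monoˡ-≤ (4 * w) (vacuous P h)) (≤-trans 4w≤M (m≤m+n M _))
    ; width = λ x P h → ≤-trans (vacuous P h) z≤n
    }
    where
    vacuous : ∀ {x} P → (∀ {v} → v ∈ P → v ∈ U × [] ≡ x) → ∣ P ∣ ≤ 0
    vacuous P h = ≤-trans (p⊆q⇒∣p∣≤∣q∣ {q = ⊥} λ v∈P → contradiction (_ , proj₁ (h v∈P)) empty)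
      (≤-reflexive (∣⊥∣≡0 n))
  build zero U S M U≤ S⊆U S≤M 4w≤M M≤D | yes (x , x∈U) =
    contradiction (subst (_≤ 0) (∣⁅x⁆∣≡1 x) (≤-trans (p⊆q⇒∣p∣≤∣q∣ {p = ⁅ x ⁆} {q = U}
      λ y∈ → subst (_∈ U) (sym (x∈⁅y⁆⇒x≡y x y∈)) x∈U) U≤)) λ ()
  build (suc fuel) U S M U≤ S⊆U S≤M 4w≤M M≤D | yes (x , x∈U) with ∣ S ∣ ≤? 12 * w | nonempty? S
  ... | no S≰12w  | _ = build-large (build fuel) U S M U≤ S⊆U S≤M M≤D (≰⇒> S≰12w) (separator U S S⊆U
    (≤-trans (*-monoʳ-≤ 12 p≤w*q) (≤-trans (≤-reflexive (sym (*-assoc 12 w q))) (*-monoˡ-≤ q (<⇒≤ (≰⇒> S≰12w))))))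
  ... | yes S≤12w | yes nonempty = build-small (build fuel) U S M U≤ S⊆U S≤M 4w≤M M≤D nonempty S≤12w
  -- An arbitrary vertex of `U` is prescribed instead, so that removing the root bag makes `U`
  -- smaller.
  ... | yes S≤12w | no empty = restrict-root (λ v∈S → contradiction (_ , v∈S) empty)
    (build-small (build fuel) U ⁅ x ⁆ M U≤ (λ y∈ → subst (_∈ U) (sym (x∈⁅y⁆⇒x≡y x y∈)) x∈U)
      (≤-trans ∣x∣≤ (≤-trans (*-monoˡ-≤ w (m≤m+n 1 3)) 4w≤M)) 4w≤M M≤D
      (x , x∈⁅x⁆ x) (≤-trans ∣x∣≤ (*-monoˡ-≤ w (m≤m+n 1 11))))
    where
    ∣x∣≤ : ∣ ⁅ x ⁆ ∣ ≤ 1 * w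
    ∣x∣≤ = subst₂ _≤_ (sym (∣⁅x⁆∣≡1 x)) (sym (*-identityˡ w)) 1≤w

  treePartition : TreePartition ⊤ ⊥ D
  treePartition = build n ⊤ ⊥ D (≤-reflexive (∣⊤∣≡n n)) ⊥⊆ (≤-trans (≤-reflexive (∣⊥∣≡0 n)) z≤n) 4w≤D ≤-refl

  -- Each floor times `q` is at most its numerator, and 2 * 12 * 5 * 2 = 240.
  2D*q³≤240p³ : 2 * D * (q * (q * q)) ≤ 240 * (p * (p * p))
  2D*q³≤240p³ = begin
    2 * D * (q * (q * q))                       ≡⟨ eq t b d q ⟩
    24 * ((t * q) * ((b * q) * (d * q)))        ≤⟨ *-monoʳ-≤ 24 (*-mono-≤ (m/n*n≤m (5 * p) q)
                                                    (*-mono-≤ (m/n*n≤m (2 * p) q) (m/n*n≤m p q))) ⟩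
    24 * ((5 * p) * ((2 * p) * p))              ≡⟨ eq′ p ⟩
    240 * (p * (p * p))                         ∎
    where
    open ≤-Reasoning
    eq : ∀ t b d q → 2 * (12 * (t * b) * d) * (q * (q * q)) ≡ 24 * ((t * q) * ((b * q) * (d * q)))
    eq = solve-∀
    eq′ : ∀ p → 24 * ((5 * p) * ((2 * p) * p)) ≡ 240 * (p * (p * p))
    eq′ = solve-∀

-- Real and rational bounds

ι : ℕ → ℚ
ι m = + m ℚ./ 1

-- `ι m` is normalised by a gcd and does not compute for a variable `m`, so comparisons pass through
-- unnormalised fractions with denominator 1.
toℚᵘ-ι : ∀ m → toℚᵘ (ι m) ℚᵘ.≃ mkℚᵘ (+ m) 0
toℚᵘ-ι m = ℚ.toℚᵘ-fromℚᵘ (mkℚᵘ (+ m) 0)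

ι-cancel-< : ∀ {m k} → ι m ℚ.< ι k → m < k
ι-cancel-< {m} {k} m<k = ℤ.drop‿+<+ (subst₂ ℤ._<_ (ℤ.*-identityʳ (+ m)) (ℤ.*-identityʳ (+ k)) (ℚᵘ.drop-*<*
  (ℚᵘ.<-respˡ-≃ (toℚᵘ-ι m) (ℚᵘ.<-respʳ-≃ (toℚᵘ-ι k) (ℚ.toℚᵘ-mono-< m<k)))))

module _ (p q-1 : ℕ) .(cop : Coprime p (suc q-1)) where
  private
    y : ℚ
    y = mkℚ (+ p) q-1 cop

  clear-denominator : ∀ f r → ι f ℚ.≤ y ℚ.* ι r → f * suc q-1 ≤ p * r
  clear-denominator f r f≤yr = subst₂ _≤_ (cong (f *_) (*-identityʳ (suc q-1))) (*-identityʳ (p * r))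
    (ℤ.drop‿+≤+ (subst₂ ℤ._≤_ (sym (ℤ.pos-* f (suc q-1 * 1)))
      (trans (cong (ℤ._* + 1) (sym (ℤ.pos-* p r))) (sym (ℤ.pos-* (p * r) 1)))
      (ℚᵘ.drop-*≤* (ℚᵘ.≤-respˡ-≃ (toℚᵘ-ι f) (ℚᵘ.≤-respʳ-≃
        (ℚᵘ.≃-trans (ℚ.toℚᵘ-homo-* y (ι r)) (ℚᵘ.*-congˡ {toℚᵘ y} (toℚᵘ-ι r)))
        (ℚ.toℚᵘ-mono-≤ f≤yr))))))

  introduce-denominator : ∀ a b → a * (suc q-1 * (suc q-1 * suc q-1)) ≤ b * (p * (p * p)) →
                          ι a ℚ.≤ ι b ℚ.* (y ℚ.* (y ℚ.* y))
  introduce-denominator a b a≤b = ℚ.toℚᵘ-cancel-≤ (ℚᵘ.≤-respˡ-≃ (ℚᵘ.≃-sym {toℚᵘ (ι a)} (toℚᵘ-ι a))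
    (ℚᵘ.≤-respʳ-≃ (ℚᵘ.≃-sym rhs) (ℚᵘ.*≤* (subst₂ ℤ._≤_
      (trans (ℤ.pos-* a (q * (q * q))) (cong (λ d → + a ℤ.* + d) (sym (+-identityʳ (q * (q * q))))))
      (begin
        + (b * (p * (p * p)))                           ≡⟨ ℤ.pos-* b _ ⟩
        + b ℤ.* + (p * (p * p))                         ≡⟨ cong (+ b ℤ.*_) (ℤ.pos-* p _) ⟩
        + b ℤ.* (+ p ℤ.* + (p * p))                     ≡⟨ cong (λ z → + b ℤ.* (+ p ℤ.* z)) (ℤ.pos-* p p) ⟩
        + b ℤ.* (+ p ℤ.* (+ p ℤ.* + p))                 ≡⟨ ℤ.*-identityʳ _ ⟨
        + b ℤ.* (+ p ℤ.* (+ p ℤ.* + p)) ℤ.* + 1         ∎)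
      (ℤ.+≤+ a≤b)))))
    where
    open ≡-Reasoning
    q : ℕ
    q = suc q-1
    rhs : toℚᵘ (ι b ℚ.* (y ℚ.* (y ℚ.* y))) ℚᵘ.≃ mkℚᵘ (+ b) 0 ℚᵘ.* (toℚᵘ y ℚᵘ.* (toℚᵘ y ℚᵘ.* toℚᵘ y))
    rhs = ℚᵘ.≃-trans (ℚ.toℚᵘ-homo-* (ι b) (y ℚ.* (y ℚ.* y))) (ℚᵘ.*-cong (toℚᵘ-ι b)
      (ℚᵘ.≃-trans (ℚ.toℚᵘ-homo-* y (y ℚ.* y)) (ℚᵘ.*-congˡ {toℚᵘ y} (ℚ.toℚᵘ-homo-* y y))))

ι-mono-≤ : ∀ {m k} → m ≤ k → ι m ℚ.≤ ι k
ι-mono-≤ {m} {k} m≤k = ℚ.toℚᵘ-cancel-≤ (ℚᵘ.≤-respˡ-≃ (ℚᵘ.≃-sym {toℚᵘ (ι m)} (toℚᵘ-ι m))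
  (ℚᵘ.≤-respʳ-≃ (ℚᵘ.≃-sym {toℚᵘ (ι k)} (toℚᵘ-ι k)) (ℚᵘ.*≤* (ℤ.*-monoʳ-≤-nonNeg (+ 1) (ℤ.+≤+ m≤k)))))

Eventually : (ℕ → Set) → Set
Eventually P = ∃ λ N → ∀ m → N ≤ m → P m

_∩ᵉ_ : ∀ {P Q} → Eventually P → Eventually Q → Eventually (λ m → P m × Q m)
(M , P) ∩ᵉ (N , Q) = M ⊔ N , λ m h → P m (m⊔n≤o⇒m≤o M N h) , Q m (m⊔n≤o⇒n≤o M N h)

p≤∣p∣ : ∀ p → p ℚ.≤ ℚ.∣ p ∣
p≤∣p∣ p with ℚ.≤-total 0ℚ p
... | inj₁ 0≤p = ℚ.≤-reflexive (sym (ℚ.0≤p⇒∣p∣≡p 0≤p))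
... | inj₂ p≤0 = ℚ.≤-trans p≤0 (ℚ.0≤∣p∣ p)

∣p-q∣<ε⇒p≤q+ε : ∀ p q {ε} → ℚ.∣ p ℚ.- q ∣ ℚ.< ε → p ℚ.≤ q ℚ.+ ε
∣p-q∣<ε⇒p≤q+ε p q {ε} close = begin
  p                          ≡⟨ solve 2 (λ p q → p := q :+ (p :- q)) refl p q ⟩
  q ℚ.+ (p ℚ.- q)            ≤⟨ ℚ.+-monoʳ-≤ q (ℚ.≤-trans (p≤∣p∣ (p ℚ.- q)) (ℚ.<⇒≤ close)) ⟩
  q ℚ.+ ε                    ∎
  where
  open ℚ.≤-Reasoning
  open +-*-Solver

⅛ 3/2 : ℚ
⅛ = + 1 ℚ./ 8
3/2 = + 3 ℚ./ 2

0<⅛ : 0ℚ ℚ.< ⅛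
0<⅛ = ℚ.positive⁻¹ ⅛

-- Satisfied by all late terms x of the sequence of c, for y = (one such term) + 1/4.
record Approximates (y x : ℚ) : Set where
  field
    0≤x   : 0ℚ ℚ.≤ x
    x+⅛≤y : x ℚ.+ ⅛ ℚ.≤ y
    1≤y   : 1ℚ ℚ.≤ y
    y≤3/2x : y ℚ.≤ 3/2 ℚ.* x
open Approximates

-- Late terms x are within 1/8 of the chosen term z, so y = z + 1/4 satisfies x + 1/8 ≤ y ≤ x + 3/8.
-- They are also at least 7/8, and x ≥ 3/4 is enough for 3/8 ≤ x/2.
approximation : (c : ℝ) → ℕ⇒ℝ 1 ≤ᵣ c → ∃ λ y → Eventually λ m → Approximates y (seq c m)
approximation c 1≤c with cauchy c ⅛ 0<⅛ | 1≤c ⅛ 0<⅛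
... | N , close | N′ , 1≤c+⅛ = z ℚ.+ (+ 1 ℚ./ 4) , N ⊔ N′ , λ m h →
  approx m (close m N (m⊔n≤o⇒m≤o N N′ h) ≤-refl) (close N m ≤-refl (m⊔n≤o⇒m≤o N N′ h))
           (1≤c+⅛ m (m⊔n≤o⇒n≤o N N′ h))
  where
  open ℚ.≤-Reasoning
  open +-*-Solver
  z : ℚ
  z = seq c N

  approx : ∀ m → ℚ.∣ seq c m ℚ.- z ∣ ℚ.< ⅛ → ℚ.∣ z ℚ.- seq c m ∣ ℚ.< ⅛ → 1ℚ ℚ.≤ seq c m ℚ.+ ⅛ →
           Approximates (z ℚ.+ (+ 1 ℚ./ 4)) (seq c m)
  approx m x~z z~x 1≤x+⅛ = record
    { 0≤x    = ℚ.≤-trans (ℚ.nonNegative⁻¹ (+ 3 ℚ./ 4)) ¾≤x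
    ; x+⅛≤y  = x+⅛≤y′
    ; 1≤y    = ℚ.≤-trans 1≤x+⅛ x+⅛≤y′
    ; y≤3/2x = begin
      z ℚ.+ (+ 1 ℚ./ 4)                         ≤⟨ ℚ.+-monoˡ-≤ (+ 1 ℚ./ 4) (∣p-q∣<ε⇒p≤q+ε z x z~x) ⟩
      x ℚ.+ ⅛ ℚ.+ (+ 1 ℚ./ 4)                   ≡⟨ solve 1 (λ x → x :+ con ⅛ :+ con (+ 1 ℚ./ 4) := x :+ con ½ :* con (+ 3 ℚ./ 4)) refl x ⟩
      x ℚ.+ ½ ℚ.* (+ 3 ℚ./ 4)                   ≤⟨ ℚ.+-monoʳ-≤ x (ℚ.*-monoˡ-≤-nonNeg ½ ¾≤x) ⟩
      x ℚ.+ ½ ℚ.* x                             ≡⟨ solve 1 (λ x → x :+ con ½ :* x := con 3/2 :* x) refl x ⟩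
      3/2 ℚ.* x                                 ∎
    }
    where
    x ½ : ℚ
    x = seq c m
    ½ = + 1 ℚ./ 2
    x+⅛≤y′ : x ℚ.+ ⅛ ℚ.≤ z ℚ.+ (+ 1 ℚ./ 4)
    x+⅛≤y′ = begin
      x ℚ.+ ⅛                    ≤⟨ ℚ.+-monoˡ-≤ ⅛ (∣p-q∣<ε⇒p≤q+ε x z x~z) ⟩
      z ℚ.+ ⅛ ℚ.+ ⅛              ≡⟨ ℚ.+-assoc z ⅛ ⅛ ⟩
      z ℚ.+ (+ 1 ℚ./ 4)          ∎
    ¾≤x : + 3 ℚ./ 4 ℚ.≤ x
    ¾≤x = begin
      + 3 ℚ./ 4                  ≤⟨ ℚ.toℚᵘ-cancel-≤ (ℚᵘ.*≤* (ℤ.+≤+ (m≤m+n 24 4))) ⟩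
      1ℚ ℚ.- ⅛                   ≤⟨ ℚ.+-monoˡ-≤ (ℚ.- ⅛) 1≤x+⅛ ⟩
      x ℚ.+ ⅛ ℚ.- ⅛              ≡⟨ solve 2 (λ x e → x :+ e :- e := x) refl x ⅛ ⟩
      x                          ∎

-- The real inequality is used with error 1/8. As r ≥ 1, the slack x + 1/8 ≤ y absorbs this error
-- and leaves an exact bound.
linear-bound : ∀ {y c} f r → Eventually (λ m → Approximates y (seq c m)) → 1 ≤ r →
               ℕ⇒ℝ f ≤ᵣ c *ᵣ ℕ⇒ℝ r → ι f ℚ.≤ y ℚ.* ι r
linear-bound {y} {c} f r approx 1≤r f≤cr = begin
  ι f                          ≤⟨ proj₂ (proj₂ joint N ≤-refl) ⟩
  x ℚ.* ι r ℚ.+ ⅛              ≡⟨ cong (x ℚ.* ι r ℚ.+_) (ℚ.*-identityʳ ⅛) ⟨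
  x ℚ.* ι r ℚ.+ ⅛ ℚ.* 1ℚ       ≤⟨ ℚ.+-monoʳ-≤ (x ℚ.* ι r) (ℚ.*-monoˡ-≤-nonNeg ⅛ (ι-mono-≤ {1} {r} 1≤r)) ⟩
  x ℚ.* ι r ℚ.+ ⅛ ℚ.* ι r      ≡⟨ ℚ.*-distribʳ-+ (ι r) x ⅛ ⟨
  (x ℚ.+ ⅛) ℚ.* ι r            ≤⟨ ℚ.*-monoʳ-≤-nonNeg (ι r) {{ℚ.nonNegative (ι-mono-≤ {0} {r} z≤n)}}
                                    (x+⅛≤y (proj₁ (proj₂ joint N ≤-refl))) ⟩
  y ℚ.* ι r                    ∎
  where
  open ℚ.≤-Reasoning
  joint : Eventually λ m → Approximates y (seq c m) × ι f ℚ.≤ seq c m ℚ.* ι r ℚ.+ ⅛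
  joint = approx ∩ᵉ f≤cr ⅛ 0<⅛
  N : ℕ
  N = proj₁ joint
  x : ℚ
  x = seq c N

*-mono-≤-nonNeg : ∀ {p q r s} → 0ℚ ℚ.≤ p → 0ℚ ℚ.≤ s → p ℚ.≤ q → r ℚ.≤ s → p ℚ.* r ℚ.≤ q ℚ.* s
*-mono-≤-nonNeg {p} {q} {r} {s} 0≤p 0≤s p≤q r≤s = ℚ.≤-trans
  (ℚ.*-monoˡ-≤-nonNeg p {{ℚ.nonNegative 0≤p}} r≤s) (ℚ.*-monoʳ-≤-nonNeg s {{ℚ.nonNegative 0≤s}} p≤q)

0≤* : ∀ {p q} → 0ℚ ℚ.≤ p → 0ℚ ℚ.≤ q → 0ℚ ℚ.≤ p ℚ.* q
0≤* {p} {q} 0≤p 0≤q = ℚ.nonNegative⁻¹ (p ℚ.* q)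
  {{ℚ.nonNeg*nonNeg⇒nonNeg p {{ℚ.nonNegative 0≤p}} q {{ℚ.nonNegative 0≤q}}}}

-- 240 times the cube of 3/2 is 810. The trailing factor `1ℚ` comes from unfolding `_^ᵣ_`.
cube-bound : ∀ {y x} → Approximates y x → ι 240 ℚ.* (y ℚ.* (y ℚ.* y)) ℚ.≤ ι 882 ℚ.* (x ℚ.* (x ℚ.* (x ℚ.* 1ℚ)))
cube-bound {y} {x} app = begin
  ι 240 ℚ.* (y ℚ.* (y ℚ.* y))
    ≤⟨ ℚ.*-monoˡ-≤-nonNeg (ι 240) (*-mono-≤-nonNeg 0≤y (0≤* 0≤z 0≤z) (y≤3/2x app)
         (*-mono-≤-nonNeg 0≤y 0≤z (y≤3/2x app) (y≤3/2x app))) ⟩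
  ι 240 ℚ.* (3/2 ℚ.* x ℚ.* (3/2 ℚ.* x ℚ.* (3/2 ℚ.* x)))
    ≡⟨ solve 1 (λ x → con (ι 240) :* (con 3/2 :* x :* (con 3/2 :* x :* (con 3/2 :* x)))
                      := con (ι 810) :* (x :* (x :* (x :* con 1ℚ)))) refl x ⟩
  ι 810 ℚ.* (x ℚ.* (x ℚ.* (x ℚ.* 1ℚ)))
    ≤⟨ ℚ.*-monoʳ-≤-nonNeg (x ℚ.* (x ℚ.* (x ℚ.* 1ℚ))) {{ℚ.nonNegative 0≤x³}} (ι-mono-≤ {810} {882} (m≤m+n 810 72)) ⟩
  ι 882 ℚ.* (x ℚ.* (x ℚ.* (x ℚ.* 1ℚ))) ∎
  where
  open ℚ.≤-Reasoning
  open +-*-Solver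
  0≤y : 0ℚ ℚ.≤ y
  0≤y = ℚ.≤-trans (ℚ.nonNegative⁻¹ 1ℚ) (1≤y app)
  0≤z : 0ℚ ℚ.≤ 3/2 ℚ.* x
  0≤z = ℚ.≤-trans 0≤y (y≤3/2x app)
  0≤x³ : 0ℚ ℚ.≤ x ℚ.* (x ℚ.* (x ℚ.* 1ℚ))
  0≤x³ = 0≤* (0≤x app) (0≤* (0≤x app) (0≤* (0≤x app) (ℚ.nonNegative⁻¹ 1ℚ)))

-- The strict real inequality provides a fixed gap ε below k + 1, which makes the comparison with a
-- late term strict.
floor-bound : ∀ {y c} a k → Eventually (λ m → Approximates y (seq c m)) → IsFloor k (ℕ⇒ℝ 882 *ᵣ c ^ᵣ 3) →
              ι a ℚ.≤ ι 240 ℚ.* (y ℚ.* (y ℚ.* y)) → a ≤ k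
floor-bound {y} {c} a k approx (_ , ε , 0<ε , below) a≤y = s≤s⁻¹ (ι-cancel-< (begin-strict
  ι a                                              ≤⟨ ℚ.≤-trans a≤y (cube-bound (proj₁ (proj₂ joint N ≤-refl))) ⟩
  ι 882 ℚ.* (x ℚ.* (x ℚ.* (x ℚ.* 1ℚ)))             ≡⟨ ℚ.+-identityʳ _ ⟨
  ι 882 ℚ.* (x ℚ.* (x ℚ.* (x ℚ.* 1ℚ))) ℚ.+ 0ℚ      <⟨ ℚ.+-monoʳ-< (ι 882 ℚ.* (x ℚ.* (x ℚ.* (x ℚ.* 1ℚ)))) 0<ε ⟩
  ι 882 ℚ.* (x ℚ.* (x ℚ.* (x ℚ.* 1ℚ))) ℚ.+ ε       ≤⟨ proj₂ (proj₂ joint N ≤-refl) ⟩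
  ι (suc k)                                        ∎))
  where
  open ℚ.≤-Reasoning
  joint : Eventually λ m → Approximates y (seq c m) × seq (ℕ⇒ℝ 882 *ᵣ c ^ᵣ 3) m ℚ.+ ε ℚ.≤ ι (suc k)
  joint = approx ∩ᵉ below
  N : ℕ
  N = proj₁ joint
  x : ℚ
  x = seq c N

-- Writing y as p/q turns the growth bound into inequalities between natural numbers. The tree is
-- the same for all graphs; only the map into it depends on `G`.
rational-theorem13 : ∀ y n (G : FiniteGraph n) → 1ℚ ℚ.≤ y → (∀ r → 1 ≤ r → ι (growth G r) ℚ.≤ y ℚ.* ι r) →
                    ∀ k → (∀ a → ι a ℚ.≤ ι 240 ℚ.* (y ℚ.* (y ℚ.* y)) → a ≤ k) →
                    IsomorphicToSubgraph (graph G) (Tree {List Bool} ⊠ K k)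
rational-theorem13 (mkℚ -[1+ _ ] _ _) n G (ℚ.*≤* ()) linear k bound
rational-theorem13 (mkℚ (+ p) q-1 cop) n G 1≤y linear k bound =
  partition⇒embedding (≡-dec (≡-dec Bool._≟_)) (bag TP)
    (λ x P h → ≤-trans (width TP x P (λ v∈ → ∈⊤ , h v∈))
      (bound (2 * D) (introduce-denominator p q-1 cop (2 * D) 240 2D*q³≤240p³)))
    Tree (graph G) (respects TP ∈⊤ ∈⊤)
  where
  q : ℕ
  q = suc q-1
  q≤p : q ≤ p
  q≤p = subst₂ _≤_ (*-identityˡ q) (*-identityʳ p) (ℤ.drop‿+≤+ (subst₂ ℤ._≤_ (sym (ℤ.pos-* 1 q)) (sym (ℤ.pos-* p 1)) (ℚ.drop-*≤* 1≤y)))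
  open Balls G using (ball)
  ball-linear : ∀ U u r → u ∈ U → 1 ≤ r → ∣ ball U u r ∣ * q ≤ p * r
  ball-linear U u r u∈U 1≤r = ≤-trans (*-monoˡ-≤ q (Balls.∣ball∣≤growth G U u∈U r))
    (clear-denominator p q-1 cop (growth G r) r (linear r 1≤r))
  open Partition G p q q≤p ball-linear
  open TreePartition
  TP : TreePartition ⊤ ⊥ D
  TP = treePartition

theorem13 : (c : ℝ) → ℕ⇒ℝ 1 ≤ᵣ c →
    (n : ℕ) (G : FiniteGraph n) →
    (∀ r → 1 ≤ r → ℕ⇒ℝ (growth G r) ≤ᵣ c *ᵣ ℕ⇒ℝ r) →
    (k : ℕ) → IsFloor k (ℕ⇒ℝ 882 *ᵣ c ^ᵣ 3) →
    Σ Set λ V → Σ (Graph V) λ T →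
    IsTree T × IsomorphicToSubgraph (graph G) (T ⊠ K k)
theorem13 c 1≤c n G linear k floor = Node , Tree , Tree-isTree , rational-theorem13 y n G
  (1≤y (proj₂ approx (proj₁ approx) ≤-refl))
  (λ r 1≤r → linear-bound {c = c} (growth G r) r approx 1≤r (linear r 1≤r))
  k (λ a → floor-bound {c = c} a k approx floor)
  where
  y : ℚ
  y = proj₁ (approximation c 1≤c)
  approx : Eventually λ m → Approximates y (seq c m)
  approx = proj₂ (approximation c 1≤c)
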